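{- Let $\Gamma$ be a nonzero $2^\ell\times 2^m$ pseudo-signature. Then $\operatorname{rank}(\Gamma)$ is a power of $2$. Equivalently, for all integers $\kappa\ge 1$, $\operatorname{rank}(\Gamma)\ge 2^\kappa+1$ implies $\operatorname{rank}(\Gamma)\ge 2^{\kappa+1}$.
   Context: For bitstrings, $\mathrm{wt}$ is Hamming weight, $\oplus$ is bitwise addition mod 2, the parity of a string is the parity of its weight, and $e_i$ is the string whose only nonzero bit is in position $i$. A $2^\ell\times 2^m$ complex matrix $\Gamma$ has rows indexed by $\{0,1\}^\ell$ and columns by $\{0,1\}^m$; $\Gamma^\sigma_\zeta$ is the entry in row $\sigma$, column $\zeta$. $\Gamma$ is a pseudo-signature if: (i) (parity condition) all pairs $(\sigma,\zeta)$ with $\Gamma^\sigma_\zeta\ne 0$ have $\mathrm{wt}(\sigma)+\mathrm{wt}(\zeta)$ of the same parity; and (ii) (matchgate identities up to sign) there are signs $\epsilon_{\zeta,\eta}=\epsilon_{\eta,\zeta}\in\{\pm1\}$ (for pairs of column indices) and $\delta_{\sigma,\tau}\in\{\pm1\}$ (for pairs of row indices) such that for all $\sigma\neq\tau$ in $\{0,1\}^\ell$ with $\mathrm{wt}(\sigma\oplus\tau)$ even and all $\zeta,\eta\in\{0,1\}^m$, writing $\sigma\oplus\tau=e_{p_1}\oplus\cdots\oplus e_{p_d}$ with $p_1<\cdots<p_d$ and $\zeta\oplus\eta=e_{q_1}\oplus\cdots\oplus e_{q_{d'}}$ with $q_1<\cdots<q_{d'}$, $$\sum_{i=1}^d(-1)^{i+1}\Gamma^{\sigma\oplus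 e_{p_1}\oplus e_{p_i}}_{\zeta}\Gamma^{\tau\oplus e_{p_1}\oplus e_{p_i}}_{\eta}=\delta_{\sigma,\tau}\,\epsilon_{\zeta,\eta}\sum_{j=1}^{d'}(-1)^{j+1}\Gamma^{\sigma\oplus e_{p_1}}_{\zeta\oplus e_{q_j}}\Gamma^{\tau\oplus e_{p_1}}_{\eta\oplus e_{q_j}}.$$ -}

module Defs where

open import Algebra.Bundles using (CommutativeRing)
import Algebra.Properties.Monoid.Sum as Sum
open import Data.Bool.Base using (Bool; _xor_)
open import Data.Bool.Properties using (T?)
open import Data.Fin.Base using (Fin)
open import Data.Fin.Subset using (⁅_⁆; ∣_∣)
open import Data.List.Base using (List; []; _∷_; map; foldr; filter; allFin)
open import Data.Nat.Base as ℕ using (ℕ; parity)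
import Data.Nat.Properties as ℕ
open import Data.Parity.Base using (0ℙ)
open import Data.Product.Base using (Σ; ∃; ∃-syntax; _×_; _,_; proj₁; proj₂)
open import Data.Rational.Base as ℚ using (ℚ; 0ℚ; 1ℚ; ½; Positive; _<_; _≤_)
import Data.Rational.Properties as ℚ
import Data.Rational.Solver as ℚ-Solver
open import Data.Sign.Base as Sign using (Sign)
open import Data.Vec.Base using (Vec; lookup; zipWith)
open import Level using (0ℓ)
open import Relation.Binary.PropositionalEquality as ≡ using (_≡_; _≢_)
open import Relation.Nullary.Negation.Core using (¬_)

------------------------------------------------------------------------
-- Real numbers: Cauchy sequences of rationals, identified when their
-- difference tends to 0. Both this equality and the equality of complex
-- numbers below are record types, so that their endpoints can be inferred.

IsCauchy : (ℕ → ℚ) → Set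
IsCauchy s = ∀ ε → 0ℚ < ε → ∃[ N ] (∀ m n → N ℕ.≤ m → N ℕ.≤ n →
             ℚ.∣ s m ℚ.- s n ∣ < ε)

record ℝ : Set where
  constructor mkℝ
  field
    seq    : ℕ → ℚ
    cauchy : IsCauchy seq

open ℝ public

infix 4 _≃_

record _≃_ (x y : ℝ) : Set where
  constructor mk≃
  field
    close : ∀ ε → 0ℚ < ε → ∃[ N ] (∀ n → N ℕ.≤ n →
            ℚ.∣ seq x n ℚ.- seq y n ∣ < ε)

open _≃_ public

half-pos : ∀ {ε} → 0ℚ < ε → 0ℚ < ½ ℚ.* ε
half-pos {ε} 0<ε = ≡.subst (_< ½ ℚ.* ε) (ℚ.*-zeroʳ ½) (ℚ.*-monoʳ-<-pos ½ 0<ε)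

halves : ∀ ε → ½ ℚ.* ε ℚ.+ ½ ℚ.* ε ≡ ε
halves ε = ≡.trans (≡.sym (ℚ.*-distribʳ-+ ε ½ ½)) (ℚ.*-identityˡ ε)

sum-bound : ∀ {ε} a b → ℚ.∣ a ∣ < ½ ℚ.* ε → ℚ.∣ b ∣ < ½ ℚ.* ε → ℚ.∣ a ℚ.+ b ∣ < ε
sum-bound {ε} a b p q = ℚ.≤-<-trans (ℚ.∣p+q∣≤∣p∣+∣q∣ a b)
  (≡.subst (ℚ.∣ a ∣ ℚ.+ ℚ.∣ b ∣ <_) (halves ε) (ℚ.+-mono-< p q))

_/⁺_ : ℚ → (B : ℚ) .{{_ : Positive B}} → ℚ
ε /⁺ B = (ℚ.1/ B) {{ℚ.pos⇒nonZero B}} ℚ.* ε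

/⁺-pos : ∀ {ε} B .{{_ : Positive B}} → 0ℚ < ε → 0ℚ < ε /⁺ B
/⁺-pos {ε} B 0<ε = ≡.subst (_< ε /⁺ B) (ℚ.*-zeroʳ r) (ℚ.*-monoʳ-<-pos r {{ℚ.1/pos⇒pos B}} 0<ε)
  where r = (ℚ.1/ B) {{ℚ.pos⇒nonZero B}}

product-bound : ∀ {ε} B .{{_ : Positive B}} a b →
                ℚ.∣ a ∣ ≤ B → ℚ.∣ b ∣ < ε /⁺ B → ℚ.∣ a ℚ.* b ∣ < ε
product-bound {ε} B a b a≤B b<ε/B = begin-strict
  ℚ.∣ a ℚ.* b ∣          ≡⟨ ℚ.∣p*q∣≡∣p∣*∣q∣ a b ⟩
  ℚ.∣ a ∣ ℚ.* ℚ.∣ b ∣    ≤⟨ ℚ.*-monoʳ-≤-nonNeg ℚ.∣ b ∣ {{ℚ.∣-∣-nonNeg b}} a≤B ⟩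
  B ℚ.* ℚ.∣ b ∣          <⟨ ℚ.*-monoʳ-<-pos B b<ε/B ⟩
  B ℚ.* (ε /⁺ B)         ≡⟨ ≡.sym (ℚ.*-assoc B _ ε) ⟩
  (B ℚ.* r) ℚ.* ε        ≡⟨ ≡.cong (ℚ._* ε) (ℚ.*-inverseʳ B {{ℚ.pos⇒nonZero B}}) ⟩
  1ℚ ℚ.* ε               ≡⟨ ℚ.*-identityˡ ε ⟩
  ε                      ∎
  where open ℚ.≤-Reasoning
        r = (ℚ.1/ B) {{ℚ.pos⇒nonZero B}}

bounded : ∀ x → ∃[ B ] Positive B × ∃[ N ] (∀ n → N ℕ.≤ n → ℚ.∣ seq x n ∣ ≤ B)
bounded x = B , ℚ.positive 0<B , N , bound
  where
  c = cauchy x 1ℚ (ℚ.positive⁻¹ 1ℚ)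
  N = proj₁ c
  B = 1ℚ ℚ.+ ℚ.∣ seq x N ∣
  0<B : 0ℚ < B
  0<B = ℚ.+-mono-<-≤ (ℚ.positive⁻¹ 1ℚ) (ℚ.0≤∣p∣ (seq x N))
  split : ∀ a b → a ≡ (a ℚ.- b) ℚ.+ b
  split = solve 2 (λ a b → a := ((a :+ (:- b)) :+ b)) ≡.refl
    where open ℚ-Solver.+-*-Solver
  bound : ∀ n → N ℕ.≤ n → ℚ.∣ seq x n ∣ ≤ B
  bound n N≤n = begin
    ℚ.∣ seq x n ∣                                ≡⟨ ≡.cong ℚ.∣_∣ (split (seq x n) (seq x N)) ⟩
    ℚ.∣ (seq x n ℚ.- seq x N) ℚ.+ seq x N ∣      ≤⟨ ℚ.∣p+q∣≤∣p∣+∣q∣ (seq x n ℚ.- seq x N) (seq x N) ⟩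
    ℚ.∣ seq x n ℚ.- seq x N ∣ ℚ.+ ℚ.∣ seq x N ∣  ≤⟨ ℚ.+-monoˡ-≤ ℚ.∣ seq x N ∣ (ℚ.<⇒≤ (proj₂ c n N N≤n ℕ.≤-refl)) ⟩
    B                                            ∎
    where open ℚ.≤-Reasoning

⊔≤ˡ : ∀ m {n o} → m ℕ.⊔ n ℕ.≤ o → m ℕ.≤ o
⊔≤ˡ m {n} = ℕ.m⊔n≤o⇒m≤o m n

⊔≤ʳ : ∀ m {n o} → m ℕ.⊔ n ℕ.≤ o → n ℕ.≤ o
⊔≤ʳ m {n} = ℕ.m⊔n≤o⇒n≤o m n

+-diff : ∀ a b c d → (a ℚ.- c) ℚ.+ (b ℚ.- d) ≡ (a ℚ.+ b) ℚ.- (c ℚ.+ d)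
+-diff = solve 4 (λ a b c d → ((a :+ (:- c)) :+ (b :+ (:- d))) := ((a :+ b) :+ (:- (c :+ d)))) ≡.refl
  where open ℚ-Solver.+-*-Solver

*-diff : ∀ a b c d → a ℚ.* (b ℚ.- d) ℚ.+ d ℚ.* (a ℚ.- c) ≡ a ℚ.* b ℚ.- c ℚ.* d
*-diff = solve 4 (λ a b c d → ((a :* (b :+ (:- d))) :+ (d :* (a :+ (:- c)))) := ((a :* b) :+ (:- (c :* d)))) ≡.refl
  where open ℚ-Solver.+-*-Solver

neg-diff : ∀ a b → ℚ.∣ (ℚ.- a) ℚ.- (ℚ.- b) ∣ ≡ ℚ.∣ a ℚ.- b ∣
neg-diff a b = ≡.trans (≡.cong ℚ.∣_∣ (distrib a b)) (ℚ.∣-p∣≡∣p∣ (a ℚ.- b))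
  where
  open ℚ-Solver.+-*-Solver
  distrib : ∀ a b → (ℚ.- a) ℚ.- (ℚ.- b) ≡ ℚ.- (a ℚ.- b)
  distrib = solve 2 (λ a b → ((:- a) :+ (:- (:- b))) := (:- (a :+ (:- b)))) ≡.refl

flip-diff : ∀ a b → ℚ.∣ a ℚ.- b ∣ ≡ ℚ.∣ b ℚ.- a ∣
flip-diff a b = ≡.trans (≡.cong ℚ.∣_∣ (distrib a b)) (ℚ.∣-p∣≡∣p∣ (b ℚ.- a))
  where
  open ℚ-Solver.+-*-Solver
  distrib : ∀ a b → a ℚ.- b ≡ ℚ.- (b ℚ.- a)
  distrib = solve 2 (λ a b → (a :+ (:- b)) := (:- (b :+ (:- a)))) ≡.refl

through : ∀ a b c → (a ℚ.- b) ℚ.+ (b ℚ.- c) ≡ a ℚ.- c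
through = solve 3 (λ a b c → ((a :+ (:- b)) :+ (b :+ (:- c))) := (a :+ (:- c))) ≡.refl
  where open ℚ-Solver.+-*-Solver

abstract

  const-cauchy : ∀ q → IsCauchy (λ _ → q)
  const-cauchy q ε 0<ε = 0 , λ _ _ _ _ →
    ≡.subst (_< ε) (≡.sym (≡.cong ℚ.∣_∣ (ℚ.+-inverseʳ q))) 0<ε

  +-cauchy : ∀ x y → IsCauchy (λ n → seq x n ℚ.+ seq y n)
  +-cauchy x y ε 0<ε =
    let M , p = cauchy x (½ ℚ.* ε) (half-pos 0<ε)
        N , q = cauchy y (½ ℚ.* ε) (half-pos 0<ε)
    in M ℕ.⊔ N , λ m n u v →
       ≡.subst (λ z → ℚ.∣ z ∣ < ε)
         (+-diff (seq x m) (seq y m) (seq x n) (seq y n))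
         (sum-bound (seq x m ℚ.- seq x n) (seq y m ℚ.- seq y n)
           (p m n (⊔≤ˡ M u) (⊔≤ˡ M v)) (q m n (⊔≤ʳ M u) (⊔≤ʳ M v)))

  neg-cauchy : ∀ x → IsCauchy (λ n → ℚ.- seq x n)
  neg-cauchy x ε 0<ε =
    let N , p = cauchy x ε 0<ε
    in N , λ m n u v → ≡.subst (_< ε) (≡.sym (neg-diff (seq x m) (seq x n))) (p m n u v)

  *-cauchy : ∀ x y → IsCauchy (λ n → seq x n ℚ.* seq y n)
  *-cauchy x y ε 0<ε =
    let B , B>0 , K , b = bounded x
        C , C>0 , L , c = bounded y
        M , p = cauchy x (((½ ℚ.* ε) /⁺ C) {{C>0}}) (/⁺-pos C {{C>0}} (half-pos 0<ε))
        N , q = cauchy y (((½ ℚ.* ε) /⁺ B) {{B>0}}) (/⁺-pos B {{B>0}} (half-pos 0<ε))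
    in (K ℕ.⊔ L) ℕ.⊔ (M ℕ.⊔ N) , λ m n u v →
       ≡.subst (λ z → ℚ.∣ z ∣ < ε)
         (*-diff (seq x m) (seq y m) (seq x n) (seq y n))
         (sum-bound (seq x m ℚ.* (seq y m ℚ.- seq y n)) (seq y n ℚ.* (seq x m ℚ.- seq x n))
           (product-bound B {{B>0}} (seq x m) (seq y m ℚ.- seq y n) (b m (⊔≤ˡ K (⊔≤ˡ (K ℕ.⊔ L) u)))
             (q m n (⊔≤ʳ M (⊔≤ʳ (K ℕ.⊔ L) u)) (⊔≤ʳ M (⊔≤ʳ (K ℕ.⊔ L) v))))
           (product-bound C {{C>0}} (seq y n) (seq x m ℚ.- seq x n) (c n (⊔≤ʳ K (⊔≤ˡ (K ℕ.⊔ L) v)))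
             (p m n (⊔≤ˡ M (⊔≤ʳ (K ℕ.⊔ L) u)) (⊔≤ˡ M (⊔≤ʳ (K ℕ.⊔ L) v)))))

infixl 6 _+ᴿ_
infixl 7 _*ᴿ_
infix  8 -ᴿ_

const : ℚ → ℝ
const q = mkℝ (λ _ → q) (const-cauchy q)

_+ᴿ_ _*ᴿ_ : ℝ → ℝ → ℝ
x +ᴿ y = mkℝ (λ n → seq x n ℚ.+ seq y n) (+-cauchy x y)
x *ᴿ y = mkℝ (λ n → seq x n ℚ.* seq y n) (*-cauchy x y)

-ᴿ_ : ℝ → ℝ
-ᴿ x = mkℝ (λ n → ℚ.- seq x n) (neg-cauchy x)

pointwise : ∀ {x y} → (∀ n → seq x n ≡ seq y n) → x ≃ y
pointwise {x} {y} eq .close ε 0<ε = 0 , λ n _ → ≡.subst (_< ε) (zero-diff n) 0<ε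
  where
  zero-diff : ∀ n → 0ℚ ≡ ℚ.∣ seq x n ℚ.- seq y n ∣
  zero-diff n = ≡.sym (≡.cong ℚ.∣_∣
    (≡.trans (≡.cong (ℚ._- seq y n) (eq n)) (ℚ.+-inverseʳ (seq y n))))

≃-sym : ∀ {x y} → x ≃ y → y ≃ x
≃-sym {x} {y} p .close ε 0<ε =
  let N , q = close p ε 0<ε
  in N , λ n u → ≡.subst (_< ε) (flip-diff (seq x n) (seq y n)) (q n u)

≃-trans : ∀ {x y z} → x ≃ y → y ≃ z → x ≃ z
≃-trans {x} {y} {z} p q .close ε 0<ε =
  let M , p′ = close p (½ ℚ.* ε) (half-pos 0<ε)
      N , q′ = close q (½ ℚ.* ε) (half-pos 0<ε)
  in M ℕ.⊔ N , λ n u →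
     ≡.subst (λ w → ℚ.∣ w ∣ < ε) (through (seq x n) (seq y n) (seq z n))
       (sum-bound (seq x n ℚ.- seq y n) (seq y n ℚ.- seq z n)
         (p′ n (⊔≤ˡ M u)) (q′ n (⊔≤ʳ M u)))

+ᴿ-cong : ∀ {x x′ y y′} → x ≃ x′ → y ≃ y′ → x +ᴿ y ≃ x′ +ᴿ y′
+ᴿ-cong {x} {x′} {y} {y′} p q .close ε 0<ε =
  let M , p′ = close p (½ ℚ.* ε) (half-pos 0<ε)
      N , q′ = close q (½ ℚ.* ε) (half-pos 0<ε)
  in M ℕ.⊔ N , λ n u →
     ≡.subst (λ w → ℚ.∣ w ∣ < ε)
       (+-diff (seq x n) (seq y n) (seq x′ n) (seq y′ n))
       (sum-bound (seq x n ℚ.- seq x′ n) (seq y n ℚ.- seq y′ n)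
         (p′ n (⊔≤ˡ M u)) (q′ n (⊔≤ʳ M u)))

-ᴿ-cong : ∀ {x y} → x ≃ y → -ᴿ x ≃ -ᴿ y
-ᴿ-cong {x} {y} p .close ε 0<ε =
  let N , q = close p ε 0<ε
  in N , λ n u → ≡.subst (_< ε) (≡.sym (neg-diff (seq x n) (seq y n))) (q n u)

*ᴿ-cong : ∀ {x x′ y y′} → x ≃ x′ → y ≃ y′ → x *ᴿ y ≃ x′ *ᴿ y′
*ᴿ-cong {x} {x′} {y} {y′} p q .close ε 0<ε =
  let B , B>0 , K , b = bounded x
      C , C>0 , L , c = bounded y′
      M , p′ = close p (((½ ℚ.* ε) /⁺ C) {{C>0}}) (/⁺-pos C {{C>0}} (half-pos 0<ε))
      N , q′ = close q (((½ ℚ.* ε) /⁺ B) {{B>0}}) (/⁺-pos B {{B>0}} (half-pos 0<ε))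
  in (K ℕ.⊔ L) ℕ.⊔ (M ℕ.⊔ N) , λ n u →
     ≡.subst (λ z → ℚ.∣ z ∣ < ε)
       (*-diff (seq x n) (seq y n) (seq x′ n) (seq y′ n))
       (sum-bound (seq x n ℚ.* (seq y n ℚ.- seq y′ n)) (seq y′ n ℚ.* (seq x n ℚ.- seq x′ n))
         (product-bound B {{B>0}} (seq x n) (seq y n ℚ.- seq y′ n) (b n (⊔≤ˡ K (⊔≤ˡ (K ℕ.⊔ L) u)))
           (q′ n (⊔≤ʳ M (⊔≤ʳ (K ℕ.⊔ L) u))))
         (product-bound C {{C>0}} (seq y′ n) (seq x n ℚ.- seq x′ n) (c n (⊔≤ʳ K (⊔≤ˡ (K ℕ.⊔ L) u)))
           (p′ n (⊔≤ˡ M (⊔≤ʳ (K ℕ.⊔ L) u)))))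

ℝ-commutativeRing : CommutativeRing 0ℓ 0ℓ
ℝ-commutativeRing = record
  { Carrier = ℝ
  ; _≈_ = _≃_
  ; _+_ = _+ᴿ_
  ; _*_ = _*ᴿ_
  ; -_  = -ᴿ_
  ; 0#  = const 0ℚ
  ; 1#  = const 1ℚ
  ; isCommutativeRing = record
    { isRing = record
      { +-isAbelianGroup = record
        { isGroup = record
          { isMonoid = record
            { isSemigroup = record
              { isMagma = record
                { isEquivalence = record
                  { refl  = pointwise λ _ → ≡.refl
                  ; sym   = ≃-sym
                  ; trans = ≃-trans
                  }
                ; ∙-cong = +ᴿ-cong
                }
              ; assoc = λ x y z → pointwise
                  λ n → ℚ.+-assoc (seq x n) (seq y n) (seq z n)
              }
            ; identity = (λ x → pointwise λ n → ℚ.+-identityˡ (seq x n))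
                       , (λ x → pointwise λ n → ℚ.+-identityʳ (seq x n))
            }
          ; inverse = (λ x → pointwise λ n → ℚ.+-inverseˡ (seq x n))
                    , (λ x → pointwise λ n → ℚ.+-inverseʳ (seq x n))
          ; ⁻¹-cong = -ᴿ-cong
          }
        ; comm = λ x y → pointwise λ n → ℚ.+-comm (seq x n) (seq y n)
        }
      ; *-cong = *ᴿ-cong
      ; *-assoc = λ x y z → pointwise
          λ n → ℚ.*-assoc (seq x n) (seq y n) (seq z n)
      ; *-identity = (λ x → pointwise λ n → ℚ.*-identityˡ (seq x n))
                   , (λ x → pointwise λ n → ℚ.*-identityʳ (seq x n))
      ; distrib = (λ x y z → pointwise
                     λ n → ℚ.*-distribˡ-+ (seq x n) (seq y n) (seq z n))
                , (λ x y z → pointwise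
                     λ n → ℚ.*-distribʳ-+ (seq x n) (seq y n) (seq z n))
      }
    ; *-comm = λ x y → pointwise λ n → ℚ.*-comm (seq x n) (seq y n)
    }
  }

------------------------------------------------------------------------
-- Complex numbers.

record ℂ : Set where
  constructor _+i_
  field
    re im : ℝ

open ℂ public

infix  4 _≋_
infixr 4 _&_

record _≋_ (z w : ℂ) : Set where
  constructor _&_
  field
    re≃ : re z ≃ re w
    im≃ : im z ≃ im w

open _≋_ public

infixl 6 _+ᶜ_
infixl 7 _*ᶜ_
infix  8 -ᶜ_

_+ᶜ_ _*ᶜ_ : ℂ → ℂ → ℂ
(a +i b) +ᶜ (c +i d) = (a +ᴿ c) +i (b +ᴿ d)
(a +i b) *ᶜ (c +i d) = (a *ᴿ c +ᴿ -ᴿ (b *ᴿ d)) +i (a *ᴿ d +ᴿ b *ᴿ c)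

-ᶜ_ : ℂ → ℂ
-ᶜ (a +i b) = (-ᴿ a) +i (-ᴿ b)

0ᶜ 1ᶜ : ℂ
0ᶜ = const 0ℚ +i const 0ℚ
1ᶜ = const 1ℚ +i const 0ℚ

private module R = CommutativeRing ℝ-commutativeRing

≋-trans : ∀ {x y z} → x ≋ y → y ≋ z → x ≋ z
≋-trans (p & q) (r & s) = R.trans p r & R.trans q s

+ᶜ-cong : ∀ {x x′ y y′} → x ≋ x′ → y ≋ y′ → x +ᶜ y ≋ x′ +ᶜ y′
+ᶜ-cong (p & q) (r & s) = R.+-cong p r & R.+-cong q s

*ᶜ-cong : ∀ {x x′ y y′} → x ≋ x′ → y ≋ y′ → x *ᶜ y ≋ x′ *ᶜ y′
*ᶜ-cong (p & q) (r & s) =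
  R.+-cong (R.*-cong p r) (R.-‿cong (R.*-cong q s)) & R.+-cong (R.*-cong p s) (R.*-cong q r)

*ᶜ-comm : ∀ x y → x *ᶜ y ≋ y *ᶜ x
*ᶜ-comm (a +i b) (c +i d) =
    R.+-cong (R.*-comm a c) (R.-‿cong (R.*-comm b d))
  & R.trans (R.+-comm (a *ᴿ d) (b *ᴿ c)) (R.+-cong (R.*-comm b c) (R.*-comm a d))

*ᶜ-assoc : ∀ x y z → (x *ᶜ y) *ᶜ z ≋ x *ᶜ (y *ᶜ z)
*ᶜ-assoc (a +i b) (c +i d) (e +i f) =
    pointwise (λ n → real (seq a n) (seq b n) (seq c n) (seq d n) (seq e n) (seq f n))
  & pointwise (λ n → imag (seq a n) (seq b n) (seq c n) (seq d n) (seq e n) (seq f n))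
  where
  open ℚ-Solver.+-*-Solver
  real = solve 6 (λ a b c d e f →
    (a :* c :+ :- (b :* d)) :* e :+ :- ((a :* d :+ b :* c) :* f) :=
    a :* (c :* e :+ :- (d :* f)) :+ :- (b :* (c :* f :+ d :* e))) ≡.refl
  imag = solve 6 (λ a b c d e f →
    (a :* c :+ :- (b :* d)) :* f :+ (a :* d :+ b :* c) :* e :=
    a :* (c :* f :+ d :* e) :+ b :* (c :* e :+ :- (d :* f))) ≡.refl

*ᶜ-identityˡ : ∀ x → 1ᶜ *ᶜ x ≋ x
*ᶜ-identityˡ (a +i b) =
    pointwise (λ n → real (seq a n) (seq b n))
  & pointwise (λ n → imag (seq a n) (seq b n))
  where
  open ℚ-Solver.+-*-Solver
  real = solve 2 (λ a b → con 1ℚ :* a :+ :- (con 0ℚ :* b) := a) ≡.refl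
  imag = solve 2 (λ a b → con 1ℚ :* b :+ con 0ℚ :* a := b) ≡.refl

*ᶜ-distribˡ : ∀ x y z → x *ᶜ (y +ᶜ z) ≋ x *ᶜ y +ᶜ x *ᶜ z
*ᶜ-distribˡ (a +i b) (c +i d) (e +i f) =
    pointwise (λ n → real (seq a n) (seq b n) (seq c n) (seq d n) (seq e n) (seq f n))
  & pointwise (λ n → imag (seq a n) (seq b n) (seq c n) (seq d n) (seq e n) (seq f n))
  where
  open ℚ-Solver.+-*-Solver
  real = solve 6 (λ a b c d e f →
    a :* (c :+ e) :+ :- (b :* (d :+ f)) :=
    (a :* c :+ :- (b :* d)) :+ (a :* e :+ :- (b :* f))) ≡.refl
  imag = solve 6 (λ a b c d e f →
    a :* (d :+ f) :+ b :* (c :+ e) :=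
    (a :* d :+ b :* c) :+ (a :* f :+ b :* e)) ≡.refl

ℂ-commutativeRing : CommutativeRing 0ℓ 0ℓ
ℂ-commutativeRing = record
  { Carrier = ℂ
  ; _≈_ = _≋_
  ; _+_ = _+ᶜ_
  ; _*_ = _*ᶜ_
  ; -_  = -ᶜ_
  ; 0#  = 0ᶜ
  ; 1#  = 1ᶜ
  ; isCommutativeRing = record
    { isRing = record
      { +-isAbelianGroup = record
        { isGroup = record
          { isMonoid = record
            { isSemigroup = record
              { isMagma = record
                { isEquivalence = record
                  { refl  = R.refl & R.refl
                  ; sym   = λ p → R.sym (re≃ p) & R.sym (im≃ p)
                  ; trans = ≋-trans
                  }
                ; ∙-cong = +ᶜ-cong
                }
              ; assoc = λ x y z → R.+-assoc (re x) (re y) (re z) & R.+-assoc (im x) (im y) (im z)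
              }
            ; identity = (λ x → R.+-identityˡ (re x) & R.+-identityˡ (im x))
                       , (λ x → R.+-identityʳ (re x) & R.+-identityʳ (im x))
            }
          ; inverse = (λ x → R.-‿inverseˡ (re x) & R.-‿inverseˡ (im x))
                    , (λ x → R.-‿inverseʳ (re x) & R.-‿inverseʳ (im x))
          ; ⁻¹-cong = λ p → R.-‿cong (re≃ p) & R.-‿cong (im≃ p)
          }
        ; comm = λ x y → R.+-comm (re x) (re y) & R.+-comm (im x) (im y)
        }
      ; *-cong = *ᶜ-cong
      ; *-assoc = *ᶜ-assoc
      ; *-identity = *ᶜ-identityˡ , λ x → ≋-trans (*ᶜ-comm x 1ᶜ) (*ᶜ-identityˡ x)
      ; distrib = *ᶜ-distribˡ , λ x y z → ≋-trans (*ᶜ-comm (y +ᶜ z) x)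
          (≋-trans (*ᶜ-distribˡ x y z) (+ᶜ-cong (*ᶜ-comm x y) (*ᶜ-comm x z)))
      }
    ; *-comm = *ᶜ-comm
    }
  }

open CommutativeRing ℂ-commutativeRing public using () renaming (_-_ to _-ᶜ_)

infixr 8 _◃_

_◃_ : Sign → ℂ → ℂ
Sign.+ ◃ z = z
Sign.- ◃ z = -ᶜ z

------------------------------------------------------------------------
-- Bitstrings.

-- Definitionally the library's `Subset n`, so that Hamming weight is
-- the cardinality ∣_∣ and the unit string eᵢ is the singleton ⁅ i ⁆.

BitString : ℕ → Set
BitString n = Vec Bool n

infixl 6 _⊕_

_⊕_ : ∀ {n} → BitString n → BitString n → BitString n
_⊕_ = zipWith _xor_

wt : ∀ {n} → BitString n → ℕ
wt = ∣_∣

e : ∀ {n} → Fin n → BitString n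
e = ⁅_⁆

-- The positions of the nonzero bits, in increasing order.

ones : ∀ {n} → BitString n → List (Fin n)
ones {n} σ = filter (λ i → T? (lookup σ i)) (allFin n)

------------------------------------------------------------------------
-- Pseudo-signatures.

-- Γ σ ζ is the entry in row σ and column ζ.

Matrix : ℕ → ℕ → Set
Matrix ℓ m = BitString ℓ → BitString m → ℂ

NonzeroMatrix : ∀ {ℓ m} → Matrix ℓ m → Set
NonzeroMatrix Γ = ¬ (∀ σ ζ → Γ σ ζ ≋ 0ᶜ)

-- x₁ - (x₂ - (x₃ - ⋯)), that is Σᵢ (-1)ⁱ⁺¹ xᵢ.

alternatingSum : List ℂ → ℂ
alternatingSum = foldr _-ᶜ_ 0ᶜ

ParityCondition : ∀ {ℓ m} → Matrix ℓ m → Set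
ParityCondition Γ = ∀ σ ζ σ′ ζ′ →
  ¬ (Γ σ ζ ≋ 0ᶜ) → ¬ (Γ σ′ ζ′ ≋ 0ᶜ) →
  parity (wt σ ℕ.+ wt ζ) ≡ parity (wt σ′ ℕ.+ wt ζ′)

-- The pattern p₁ ∷ ps is always available, since σ ≢ τ.

MatchgateIdentitiesUpToSign : ∀ {ℓ m} → Matrix ℓ m → Set
MatchgateIdentitiesUpToSign {ℓ} {m} Γ =
  Σ (BitString m → BitString m → Sign) λ ε →
  Σ (BitString ℓ → BitString ℓ → Sign) λ δ →
    (∀ ζ η → ε ζ η ≡ ε η ζ) ×
    (∀ σ τ → σ ≢ τ → parity (wt (σ ⊕ τ)) ≡ 0ℙ →
     ∀ ζ η p₁ ps → ones (σ ⊕ τ) ≡ p₁ ∷ ps →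
       alternatingSum
         (map (λ p → Γ (σ ⊕ e p₁ ⊕ e p) ζ *ᶜ Γ (τ ⊕ e p₁ ⊕ e p) η) (p₁ ∷ ps))
       ≋
       (δ σ τ Sign.* ε ζ η) ◃ alternatingSum
         (map (λ q → Γ (σ ⊕ e p₁) (ζ ⊕ e q) *ᶜ Γ (τ ⊕ e p₁) (η ⊕ e q)) (ones (ζ ⊕ η))))

IsPseudoSignature : ∀ {ℓ m} → Matrix ℓ m → Set
IsPseudoSignature Γ = ParityCondition Γ × MatchgateIdentitiesUpToSign Γ

------------------------------------------------------------------------
-- Rank.

open Sum (CommutativeRing.+-monoid ℂ-commutativeRing) public using (sum)

IndependentColumns : ∀ {ℓ m r} → Matrix ℓ m → (Fin r → BitString m) → Set
IndependentColumns {r = r} Γ c = (a : Fin r → ℂ) →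
  (∀ σ → sum (λ k → a k *ᶜ Γ σ (c k)) ≋ 0ᶜ) → ∀ k → a k ≋ 0ᶜ

-- The rank is the largest size of a linearly independent family of
-- columns.  It is a relation rather than a function because equality of
-- complex numbers is not decidable; it determines r uniquely.

HasRank : ∀ {ℓ m} → Matrix ℓ m → ℕ → Set
HasRank {m = m} Γ r =
  (∃[ c ] IndependentColumns {r = r} Γ c) ×
  (∀ s (c : Fin s → BitString m) → IndependentColumns Γ c → s ℕ.≤ r)

{-# OPTIONS --safe #-}

-- Write x ⟨ τ ⟩ for the value at row τ of a linear combination x of columns.
-- Antisymmetrised, the matchgate identities say: if Σⱼ cⱼ Γ^(ρⱼ) = 0 is a
-- relation between rows of one parity, then for all x, y and every row β of
-- that parity
--   Σⱼ cⱼ Σ_p ± (x ⟨ β ⊕ e p ⟩ y ⟨ ρⱼ ⊕ e p ⟩ − y ⟨ β ⊕ e p ⟩ x ⟨ ρⱼ ⊕ e p ⟩) = 0,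
-- the symmetry of the signs ε being what makes this true also when some ρⱼ is β.
-- If no two adjacent rows are both nonzero, it follows that rows of equal parity
-- are proportional, so the rank is 1 or 2.  Otherwise two adjacent nonzero rows
-- form a one-dimensional subcube of independent rows; enlarge it to a maximal
-- such subcube.  Were a row adjacent to the subcube outside its span, the
-- identity with β the neighbouring vertex would show that the subcube doubled in
-- that direction is still independent.  So all adjacent rows lie in the span, and
-- by induction on the distance from the subcube all rows do: the rank is its
-- number 2 ^ κ of vertices.
--
-- Equality in ℂ is not decidable, but z ≋ 0 is stable under double negation and
-- r ≡ 2 ^ κ is decidable, so the case distinctions take place under ¬ ¬.

module Submission where

open import Defs
open import Algebra.Bundles using (CommutativeRing)
import Algebra.Properties.Ring as RingProperties
import Algebra.Properties.Semiring.Mult.TCOptimised as Multiples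
import Algebra.Properties.Semiring.Sum as SemiringSum
import Algebra.Solver.Ring as RingSolver
open import Algebra.Solver.Ring.AlmostCommutativeRing using (_-Raw-AlmostCommutative⟶_; fromCommutativeRing)
open import Data.Bool.Base using (true; false; not; _∧_; _xor_; if_then_else_)
import Data.Bool.Properties as Bool
open import Data.Fin.Base as Fin using (Fin; zero; suc; _↑ˡ_; _↑ʳ_; punchIn; splitAt)
import Data.Fin.Properties as Fin
open import Data.Fin.Subset using (⊥)
open import Data.Fin.Subset.Properties using (∣⁅x⁆∣≡1)
open import Data.Integer.Base as ℤ using (ℤ; +_; -[1+_])
import Data.Integer.Properties as ℤ
open import Data.List.Base as List using (List; []; _∷_; map; foldr; filter; allFin)
import Data.List.Properties as List
import Data.Maybe.Base as Maybe
open import Data.Nat.Base as ℕ using (ℕ; zero; suc; parity)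
import Data.Nat.Properties as ℕ
open import Data.Parity.Base as ℙ using (Parity; 0ℙ; 1ℙ)
import Data.Parity.Properties as ℙ
open import Data.Product.Base using (Σ; ∃-syntax; _×_; _,_; proj₁; proj₂)
open import Data.Rational.Base as ℚ using (ℚ; 0ℚ; 1ℚ; ½)
import Data.Rational.Properties as ℚ
import Data.Rational.Solver as ℚ-Solver
open import Data.Sign.Base as Sign using (Sign)
open import Data.Sum.Base using (inj₁; inj₂)
open import Data.Vec.Base using ([]; _∷_; lookup; zipWith)
open import Data.Vec.Functional using (_++_) renaming (_∷_ to _◂_)
open import Data.Vec.Functional.Properties using (lookup-++ˡ; lookup-++ʳ)
import Data.Vec.Properties as Vec
open import Function.Base using (_∘_; case_of_; id)
open import Level using (0ℓ)
open import Relation.Binary.PropositionalEquality as ≡ using (_≡_; _≢_; module ≡-Reasoning)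
import Relation.Binary.Reasoning.Setoid as SetoidReasoning
open import Relation.Nullary.Decidable.Core using (Dec; yes; no; does; dec⇒maybe; decidable-stable)
open import Relation.Nullary.Negation.Core using (¬_; contradiction)

-- Real and complex numbers

private module ℝ′ = CommutativeRing ℝ-commutativeRing

0ᴿ : ℝ
0ᴿ = const 0ℚ

-- A positive form of `x` being nonzero: the absolute values eventually stay above a fixed `ε`. It
-- supplies the bound needed for cancelling.
record Apart (x : ℝ) : Set where
  constructor apart
  field
    ε     : ℚ
    0<ε   : 0ℚ ℚ.< ε
    N     : ℕ
    bound : ∀ n → N ℕ.≤ n → ε ℚ.≤ ℚ.∣ seq x n ∣

∣x-0∣ : ∀ p → ℚ.∣ p ℚ.- 0ℚ ∣ ≡ ℚ.∣ p ∣
∣x-0∣ p = ≡.cong ℚ.∣_∣ (ℚ.+-identityʳ p)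

≃0⁺ : ∀ {x} → (∀ ε → 0ℚ ℚ.< ε → ∃[ N ] (∀ n → N ℕ.≤ n → ℚ.∣ seq x n ∣ ℚ.< ε)) → x ≃ 0ᴿ
≃0⁺ {x} h .close ε 0<ε = let N , b = h ε 0<ε in
  N , λ n N≤n → ≡.subst (ℚ._< ε) (≡.sym (∣x-0∣ (seq x n))) (b n N≤n)

≃0⁻ : ∀ {x} → x ≃ 0ᴿ → ∀ ε → 0ℚ ℚ.< ε → ∃[ N ] (∀ n → N ℕ.≤ n → ℚ.∣ seq x n ∣ ℚ.< ε)
≃0⁻ {x} x≃0 ε 0<ε = let N , b = close x≃0 ε 0<ε in
  N , λ n N≤n → ≡.subst (ℚ._< ε) (∣x-0∣ (seq x n)) (b n N≤n)

¬apart∧≃0 : ∀ {x} → Apart x → ¬ (x ≃ 0ᴿ)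
¬apart∧≃0 (apart ε 0<ε M big) x≃0 =
  let N , small = ≃0⁻ x≃0 ε 0<ε
      n = M ℕ.⊔ N
  in ℚ.<-irrefl ≡.refl (ℚ.≤-<-trans (big n (ℕ.m≤m⊔n M N)) (small n (ℕ.m≤n⊔m M N)))

-- Compare a far enough term x_N with ε/2: either the tail stays below ε, or it
-- stays above ε/4.
¬apart⇒≃0 : ∀ {x} → ¬ Apart x → x ≃ 0ᴿ
¬apart⇒≃0 {x} ¬apart = ≃0⁺ tail
  where
  rejoin : ∀ a b → (a ℚ.- b) ℚ.+ b ≡ a
  rejoin = solve 2 (λ a b → ((a :+ (:- b)) :+ b) := a) ≡.refl
    where open ℚ-Solver.+-*-Solver

  tail : ∀ ε → 0ℚ ℚ.< ε → ∃[ N ] (∀ n → N ℕ.≤ n → ℚ.∣ seq x n ∣ ℚ.< ε)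
  tail ε 0<ε with cauchy x (½ ℚ.* (½ ℚ.* ε)) (half-pos (half-pos 0<ε))
  ... | N , near with ℚ.∣ seq x N ∣ ℚ.<? ½ ℚ.* ε
  ...   | yes small = N , λ n N≤n → ≡.subst (λ p → ℚ.∣ p ∣ ℚ.< ε) (rejoin (seq x n) (seq x N))
            (sum-bound (seq x n ℚ.- seq x N) (seq x N)
              (ℚ.<-trans (near n N N≤n ℕ.≤-refl) (half<self (half-pos 0<ε))) small)
    where
    half<self : ∀ {η} → 0ℚ ℚ.< η → ½ ℚ.* η ℚ.< η
    half<self {η} 0<η = ≡.subst₂ ℚ._<_ (ℚ.+-identityʳ (½ ℚ.* η)) (halves η) (ℚ.+-monoʳ-< (½ ℚ.* η) (half-pos 0<η))
  ...   | no big = contradiction (apart η (half-pos (half-pos 0<ε)) N far) ¬apart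
    where
    η = ½ ℚ.* (½ ℚ.* ε)
    far : ∀ n → N ℕ.≤ n → η ℚ.≤ ℚ.∣ seq x n ∣
    far n N≤n with ℚ.≤-total η ℚ.∣ seq x n ∣
    ... | inj₁ η≤ = η≤
    ... | inj₂ ≤η = contradiction (begin-strict
        ℚ.∣ seq x N ∣                                 ≡⟨ ≡.cong ℚ.∣_∣ (rejoin (seq x N) (seq x n)) ⟨
        ℚ.∣ (seq x N ℚ.- seq x n) ℚ.+ seq x n ∣       ≤⟨ ℚ.∣p+q∣≤∣p∣+∣q∣ (seq x N ℚ.- seq x n) (seq x n) ⟩
        ℚ.∣ seq x N ℚ.- seq x n ∣ ℚ.+ ℚ.∣ seq x n ∣   <⟨ ℚ.+-mono-<-≤ (near N n ℕ.≤-refl N≤n) ≤η ⟩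
        η ℚ.+ η                                       ≡⟨ halves (½ ℚ.* ε) ⟩
        ½ ℚ.* ε                                       ∎) big
      where
      open ℚ.≤-Reasoning

-- Being zero is equivalent to the negation of `Apart`, and negations are stable.
≃0-stable : ∀ {x} → ¬ ¬ (x ≃ 0ᴿ) → x ≃ 0ᴿ
≃0-stable ¬¬x≃0 = ¬apart⇒≃0 λ x#0 → ¬¬x≃0 (¬apart∧≃0 x#0)

-- Cancelling the lower bound `ε` of `x` suffices: in absolute value, `y` is below `η` as soon as
-- `x *ᴿ y` is below `ε ℚ.* η`.
*-cancel-apart : ∀ {x y} → Apart x → x *ᴿ y ≃ 0ᴿ → y ≃ 0ᴿ
*-cancel-apart {x} {y} (apart ε 0<ε M big) xy≃0 = ≃0⁺ λ η 0<η →
  let instance ε⁺ = ℚ.positive 0<ε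
      N , small = ≃0⁻ xy≃0 (ε ℚ.* η) (≡.subst (ℚ._< ε ℚ.* η) (ℚ.*-zeroʳ ε) (ℚ.*-monoʳ-<-pos ε 0<η))
  in M ℕ.⊔ N , λ n u → ℚ.*-cancelˡ-<-nonNeg ε {{ℚ.pos⇒nonNeg ε}} (ℚ.≤-<-trans
       (ℚ.*-monoʳ-≤-nonNeg ℚ.∣ seq y n ∣ {{ℚ.∣-∣-nonNeg (seq y n)}} (big n (⊔≤ˡ M u)))
       (≡.subst (ℚ._< ε ℚ.* η) (ℚ.∣p*q∣≡∣p∣*∣q∣ (seq x n) (seq y n)) (small n (⊔≤ʳ M u))))

∣p∣*∣p∣≡p*p : ∀ p → ℚ.∣ p ∣ ℚ.* ℚ.∣ p ∣ ≡ p ℚ.* p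
∣p∣*∣p∣≡p*p p with ℚ.∣p∣≡p∨∣p∣≡-p p
... | inj₁ eq = ≡.cong₂ ℚ._*_ eq eq
... | inj₂ eq = ≡.trans (≡.cong₂ ℚ._*_ eq eq) (neg-sq p)
  where
  neg-sq : ∀ a → (ℚ.- a) ℚ.* (ℚ.- a) ≡ a ℚ.* a
  neg-sq = solve 1 (λ a → ((:- a) :* (:- a)) := (a :* a)) ≡.refl
    where open ℚ-Solver.+-*-Solver

*-mono-≤-nonNeg : ∀ {p q r s} → 0ℚ ℚ.≤ p → 0ℚ ℚ.≤ s → p ℚ.≤ q → r ℚ.≤ s → p ℚ.* r ℚ.≤ q ℚ.* s
*-mono-≤-nonNeg {p} {q} {r} {s} 0≤p 0≤s p≤q r≤s = ℚ.≤-trans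
  (ℚ.*-monoˡ-≤-nonNeg p {{ℚ.nonNegative 0≤p}} r≤s) (ℚ.*-monoʳ-≤-nonNeg s {{ℚ.nonNegative 0≤s}} p≤q)

apart-sum-of-squares : ∀ {a} b → Apart a → Apart (a *ᴿ a +ᴿ b *ᴿ b)
apart-sum-of-squares {a} b (apart ε 0<ε N big) = apart (ε ℚ.* ε)
  (≡.subst (ℚ._< ε ℚ.* ε) (ℚ.*-zeroʳ ε) (ℚ.*-monoʳ-<-pos ε {{ℚ.positive 0<ε}} 0<ε)) N
  λ n N≤n → let p = seq a n; q = seq b n in begin
    ε ℚ.* ε                                                ≡⟨ ℚ.+-identityʳ (ε ℚ.* ε) ⟨
    ε ℚ.* ε ℚ.+ 0ℚ                                         ≤⟨ ℚ.+-mono-≤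
      (*-mono-≤-nonNeg (ℚ.<⇒≤ 0<ε) (ℚ.0≤∣p∣ p) (big n N≤n) (big n N≤n))
      (*-mono-≤-nonNeg {r = 0ℚ} ℚ.≤-refl (ℚ.0≤∣p∣ q) (ℚ.0≤∣p∣ q) (ℚ.0≤∣p∣ q)) ⟩
    ℚ.∣ p ∣ ℚ.* ℚ.∣ p ∣ ℚ.+ ℚ.∣ q ∣ ℚ.* ℚ.∣ q ∣            ≡⟨ ≡.cong₂ ℚ._+_ (∣p∣*∣p∣≡p*p p) (∣p∣*∣p∣≡p*p q) ⟩
    p ℚ.* p ℚ.+ q ℚ.* q                                    ≤⟨ p≤∣p∣ _ ⟩
    ℚ.∣ p ℚ.* p ℚ.+ q ℚ.* q ∣                              ∎
  where
  open ℚ.≤-Reasoning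
  p≤∣p∣ : ∀ p → p ℚ.≤ ℚ.∣ p ∣
  p≤∣p∣ p with ℚ.≤-total 0ℚ p
  ... | inj₁ 0≤p = ℚ.≤-reflexive (≡.sym (ℚ.0≤p⇒∣p∣≡p 0≤p))
  ... | inj₂ p≤0 = ℚ.≤-trans p≤0 (ℚ.0≤∣p∣ p)

-- Zero in the complex numbers

≋0-stable : ∀ z → ¬ ¬ (z ≋ 0ᶜ) → z ≋ 0ᶜ
≋0-stable z ¬¬z≋0 = ≃0-stable (λ ¬re → ¬¬z≋0 (λ z≋0 → ¬re (re≃ z≋0)))
                  & ≃0-stable (λ ¬im → ¬¬z≋0 (λ z≋0 → ¬im (im≃ z≋0)))

1ᶜ≉0ᶜ : ¬ (1ᶜ ≋ 0ᶜ)
1ᶜ≉0ᶜ (re≃0 & _) = ¬apart∧≃0 (apart 1ℚ (ℚ.positive⁻¹ 1ℚ) 0 λ _ _ → ℚ.≤-refl) re≃0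

-- Multiplying `z *ᶜ w` by the conjugate of `z` gives `w` times the squared norm of `z`, a real
-- number that is apart from zero once either part of `z` is.
*ᶜ-noZeroDivisors : ∀ z w → ¬ (z ≋ 0ᶜ) → z *ᶜ w ≋ 0ᶜ → w ≋ 0ᶜ
*ᶜ-noZeroDivisors z@(a +i b) w@(c +i d) z≉0 (re≃0 & im≃0) = ≋0-stable w λ w≉0 →
  let norm#0⇒⊥ : Apart (a *ᴿ a +ᴿ b *ᴿ b) → _
      norm#0⇒⊥ norm#0 = w≉0 (*-cancel-apart norm#0 norm*c≃0 & *-cancel-apart norm#0 norm*d≃0)
  in z≉0 ( ¬apart⇒≃0 (λ a#0 → norm#0⇒⊥ (apart-sum-of-squares b a#0))
         & ¬apart⇒≃0 (λ b#0 → norm#0⇒⊥ (swap-squares (apart-sum-of-squares a b#0))))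
  where
  open ℝ′ using (trans; +-cong; *-congˡ; -‿cong)
  open ℚ-Solver.+-*-Solver
  swap-squares : Apart (b *ᴿ b +ᴿ a *ᴿ a) → Apart (a *ᴿ a +ᴿ b *ᴿ b)
  swap-squares (apart ε 0<ε N big) = apart ε 0<ε N λ n N≤n →
    ≡.subst (λ p → ε ℚ.≤ ℚ.∣ p ∣) (ℚ.+-comm (seq b n ℚ.* seq b n) _) (big n N≤n)
  norm*c≃0 : (a *ᴿ a +ᴿ b *ᴿ b) *ᴿ c ≃ 0ᴿ
  norm*c≃0 = trans (pointwise λ n → eq (seq a n) (seq b n) (seq c n) (seq d n))
    (trans (+-cong (*-congˡ {a} re≃0) (*-congˡ {b} im≃0))
      (pointwise λ n → zeros (seq a n) (seq b n)))
    where
    eq = solve 4 (λ a b c d → (a :* a :+ b :* b) :* c :=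
      a :* (a :* c :+ :- (b :* d)) :+ b :* (a :* d :+ b :* c)) ≡.refl
    zeros = solve 2 (λ a b → a :* con 0ℚ :+ b :* con 0ℚ := con 0ℚ) ≡.refl
  norm*d≃0 : (a *ᴿ a +ᴿ b *ᴿ b) *ᴿ d ≃ 0ᴿ
  norm*d≃0 = trans (pointwise λ n → eq (seq a n) (seq b n) (seq c n) (seq d n))
    (trans (+-cong (*-congˡ {a} im≃0) (-‿cong (*-congˡ {b} re≃0)))
      (pointwise λ n → zeros (seq a n) (seq b n)))
    where
    eq = solve 4 (λ a b c d → (a :* a :+ b :* b) :* d :=
      a :* (a :* d :+ b :* c) :+ :- (b :* (a :* c :+ :- (b :* d)))) ≡.refl
    zeros = solve 2 (λ a b → a :* con 0ℚ :+ :- (b :* con 0ℚ) := con 0ℚ) ≡.refl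

z+z≋0⇒z≋0 : ∀ z → z +ᶜ z ≋ 0ᶜ → z ≋ 0ᶜ
z+z≋0⇒z≋0 (a +i b) (re≃0 & im≃0) = halve re≃0 & halve im≃0
  where
  halve : ∀ {x} → x +ᴿ x ≃ 0ᴿ → x ≃ 0ᴿ
  halve {x} 2x≃0 = *-cancel-apart {const (1ℚ ℚ.+ 1ℚ)}
    (apart (1ℚ ℚ.+ 1ℚ) (ℚ.positive⁻¹ (1ℚ ℚ.+ 1ℚ)) 0 λ _ _ → ℚ.≤-refl)
    (ℝ′.trans (pointwise λ n → double (seq x n)) 2x≃0)
    where
    open ℚ-Solver.+-*-Solver
    double = solve 1 (λ x → (con (1ℚ ℚ.+ 1ℚ)) :* x := x :+ x) ≡.refl

-- Linear algebra

-- Unlike the solvers with coefficients in ℕ or in the ring itself, integer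
-- coefficients make terms of opposite sign cancel.
module IntegerSolver (R : CommutativeRing 0ℓ 0ℓ) where

  open CommutativeRing R hiding (zero)
  open RingProperties ring using (-‿distribˡ-*; -‿distribʳ-*; -0#≈0#; -‿+-comm; -‿involutive)
  open Multiples semiring renaming (_×_ to _·_)
  open SetoidReasoning setoid

  ⟦_⟧ : ℤ → Carrier
  ⟦ + n ⟧      = n · 1#
  ⟦ -[1+ n ] ⟧ = - (suc n · 1#)

  suc-· : ∀ n → suc n · 1# ≈ 1# + n · 1#
  suc-· n = ×-homo-+ 1# 1 n

  ⟦⊖⟧ : ∀ m n → ⟦ m ℤ.⊖ n ⟧ ≈ m · 1# - n · 1#
  ⟦⊖⟧ zero    zero    = sym (-‿inverseʳ 0#)
  ⟦⊖⟧ zero    (suc n) = sym (+-identityˡ _)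
  ⟦⊖⟧ (suc m) zero    = sym (trans (+-congˡ -0#≈0#) (+-identityʳ _))
  ⟦⊖⟧ (suc m) (suc n) = begin
    ⟦ suc m ℤ.⊖ suc n ⟧                   ≡⟨ ≡.cong ⟦_⟧ (ℤ.[1+m]⊖[1+n]≡m⊖n m n) ⟩
    ⟦ m ℤ.⊖ n ⟧                           ≈⟨ ⟦⊖⟧ m n ⟩
    m · 1# - n · 1#                       ≈⟨ +-congʳ (trans (+-congˡ (-‿inverseʳ 1#)) (+-identityʳ _)) ⟨
    (m · 1# + (1# - 1#)) - n · 1#         ≈⟨ +-congʳ (+-assoc _ _ _) ⟨
    ((m · 1# + 1#) - 1#) - n · 1#         ≈⟨ +-assoc _ _ _ ⟩
    (m · 1# + 1#) + (- 1# - n · 1#)       ≈⟨ +-cong (+-comm _ _) (-‿+-comm _ _) ⟩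
    (1# + m · 1#) - (1# + n · 1#)         ≈⟨ +-cong (suc-· m) (-‿cong (suc-· n)) ⟨
    suc m · 1# - suc n · 1#               ∎

  ⟦+⟧ : ∀ i j → ⟦ i ℤ.+ j ⟧ ≈ ⟦ i ⟧ + ⟦ j ⟧
  ⟦+⟧ (+ m)    (+ n)    = ×-homo-+ 1# m n
  ⟦+⟧ (+ m)    -[1+ n ] = ⟦⊖⟧ m (suc n)
  ⟦+⟧ -[1+ m ] (+ n)    = trans (⟦⊖⟧ n (suc m)) (+-comm _ _)
  ⟦+⟧ -[1+ m ] -[1+ n ] = begin
    - (suc (suc (m ℕ.+ n)) · 1#)      ≡⟨ ≡.cong (λ k → - (k · 1#)) (ℕ.+-suc (suc m) n) ⟨
    - ((suc m ℕ.+ suc n) · 1#)        ≈⟨ -‿cong (×-homo-+ 1# (suc m) (suc n)) ⟩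
    - (suc m · 1# + suc n · 1#)       ≈⟨ -‿+-comm _ _ ⟨
    - (suc m · 1#) - suc n · 1#       ∎

  ⟦-⟧ : ∀ i → ⟦ ℤ.- i ⟧ ≈ - ⟦ i ⟧
  ⟦-⟧ (+ zero)  = sym -0#≈0#
  ⟦-⟧ (+ suc n) = refl
  ⟦-⟧ -[1+ n ]  = sym (-‿involutive _)

  ⟦+*⟧ : ∀ m j → ⟦ + m ℤ.* j ⟧ ≈ m · 1# * ⟦ j ⟧
  ⟦+*⟧ m (+ n) = trans (reflexive (≡.cong ⟦_⟧ (≡.sym (ℤ.pos-* m n)))) (×1-homo-* m n)
  ⟦+*⟧ m -[1+ n ] = begin
    ⟦ + m ℤ.* (ℤ.- (+ suc n)) ⟧       ≡⟨ ≡.cong ⟦_⟧ (ℤ.neg-distribʳ-* (+ m) (+ suc n)) ⟨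
    ⟦ ℤ.- (+ m ℤ.* + suc n) ⟧         ≈⟨ ⟦-⟧ (+ m ℤ.* + suc n) ⟩
    - ⟦ + m ℤ.* + suc n ⟧             ≈⟨ -‿cong (⟦+*⟧ m (+ suc n)) ⟩
    - (m · 1# * suc n · 1#)           ≈⟨ -‿distribʳ-* _ _ ⟩
    m · 1# * - (suc n · 1#)           ∎

  ⟦*⟧ : ∀ i j → ⟦ i ℤ.* j ⟧ ≈ ⟦ i ⟧ * ⟦ j ⟧
  ⟦*⟧ (+ m)    j = ⟦+*⟧ m j
  ⟦*⟧ -[1+ m ] j = begin
    ⟦ (ℤ.- (+ suc m)) ℤ.* j ⟧         ≡⟨ ≡.cong ⟦_⟧ (ℤ.neg-distribˡ-* (+ suc m) j) ⟨
    ⟦ ℤ.- (+ suc m ℤ.* j) ⟧           ≈⟨ ⟦-⟧ (+ suc m ℤ.* j) ⟩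
    - ⟦ + suc m ℤ.* j ⟧               ≈⟨ -‿cong (⟦+*⟧ (suc m) j) ⟩
    - (suc m · 1# * ⟦ j ⟧)            ≈⟨ -‿distribˡ-* _ _ ⟩
    - (suc m · 1#) * ⟦ j ⟧            ∎

  homomorphism : ℤ.+-*-rawRing -Raw-AlmostCommutative⟶ fromCommutativeRing R
  homomorphism = record
    { ⟦_⟧    = ⟦_⟧
    ; +-homo = ⟦+⟧
    ; *-homo = ⟦*⟧
    ; -‿homo = ⟦-⟧
    ; 0-homo = refl
    ; 1-homo = refl
    }

  open RingSolver ℤ.+-*-rawRing (fromCommutativeRing R) homomorphism
    (λ i j → Maybe.map (reflexive ∘ ≡.cong ⟦_⟧) (dec⇒maybe (i ℤ.≟ j))) public
    using (solve; con; _:=_; _:+_; _:*_; :-_; _:-_)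

-- These are the properties of ℂ on which the argument rests: a domain of characteristic other than
-- two, with stable equality to zero. There are no inverses, so elimination proceeds by
-- cross-multiplication.
record StableDomain : Set₁ where
  field
    ring : CommutativeRing 0ℓ 0ℓ
  open CommutativeRing ring public hiding (ring; zero)
  field
    ≈0-stable      : ∀ x → ¬ ¬ (x ≈ 0#) → x ≈ 0#
    noZeroDivisors : ∀ x y → ¬ (x ≈ 0#) → x * y ≈ 0# → y ≈ 0#
    1≉0            : ¬ (1# ≈ 0#)
    x+x≈0⇒x≈0      : ∀ x → x + x ≈ 0# → x ≈ 0#

module LinearAlgebra (D : StableDomain) where

  open StableDomain D
  private module S = SemiringSum semiring
  open SetoidReasoning setoid
  open IntegerSolver ring using (solve; _:=_; _:+_; _:*_; :-_; _:-_; con)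

  open RingProperties (CommutativeRing.ring ring) public using (-0#≈0#; x[y-z]≈xy-xz)

  x≈0⇒xy≈0 : ∀ {x} y → x ≈ 0# → x * y ≈ 0#
  x≈0⇒xy≈0 y x≈0 = trans (*-congʳ x≈0) (zeroˡ y)

  y≈0⇒xy≈0 : ∀ x {y} → y ≈ 0# → x * y ≈ 0#
  y≈0⇒xy≈0 x y≈0 = trans (*-congˡ y≈0) (zeroʳ x)

  -‿≈0 : ∀ {x} → x ≈ 0# → - x ≈ 0#
  -‿≈0 x≈0 = trans (-‿cong x≈0) -0#≈0#

  +-≈0 : ∀ {x y} → x ≈ 0# → y ≈ 0# → x + y ≈ 0#
  +-≈0 x≈0 y≈0 = trans (+-cong x≈0 y≈0) (+-identityˡ 0#)

  *-≉0 : ∀ {x y} → ¬ (x ≈ 0#) → ¬ (y ≈ 0#) → ¬ (x * y ≈ 0#)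
  *-≉0 x≉0 y≉0 xy≈0 = y≉0 (noZeroDivisors _ _ x≉0 xy≈0)

  -- Opaque, so that unification can read the summand off a sum.
  opaque

    ∑ : ∀ {n} → (Fin n → Carrier) → Carrier
    ∑ = S.sum

    ∑≡sum : ∀ {n} {f : Fin n → Carrier} → ∑ f ≡ S.sum f
    ∑≡sum = ≡.refl

    ∑-suc : ∀ {n} {f : Fin (suc n) → Carrier} → ∑ f ≈ f zero + ∑ (f ∘ suc)
    ∑-suc = refl

    ∑-cong : ∀ {n} {f g : Fin n → Carrier} → (∀ i → f i ≈ g i) → ∑ f ≈ ∑ g
    ∑-cong = S.sum-cong-≋

    ∑-≈0 : ∀ {n} {f : Fin n → Carrier} → (∀ i → f i ≈ 0#) → ∑ f ≈ 0#
    ∑-≈0 {n} f≈0 = trans (∑-cong f≈0) (S.sum-replicate-zero n)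

    ∑-+ : ∀ {n} {f g : Fin n → Carrier} → ∑ (λ i → f i + g i) ≈ ∑ f + ∑ g
    ∑-+ {f = f} {g} = S.∑-distrib-+ f g

    ∑-neg : ∀ {n} {f : Fin n → Carrier} → ∑ (λ i → - f i) ≈ - ∑ f
    ∑-neg {zero}      = sym (-‿≈0 refl)
    ∑-neg {suc n} {f} = trans (+-congˡ (∑-neg {f = f ∘ suc}))
      (solve 2 (λ x y → (:- x) :+ (:- y) := :- (x :+ y)) refl (f zero) (∑ (f ∘ suc)))

    *-∑ : ∀ {n} x {f : Fin n → Carrier} → x * ∑ f ≈ ∑ (λ i → x * f i)
    *-∑ x {f} = S.*-distribˡ-sum x f

    ∑-swap : ∀ {m n} {f : Fin m → Fin n → Carrier} → ∑ (λ i → ∑ (λ j → f i j)) ≈ ∑ (λ j → ∑ (λ i → f i j))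
    ∑-swap {f = f} = S.∑-comm f

    ∑-single : ∀ {n} {f : Fin n → Carrier} i → (∀ j → j ≢ i → f j ≈ 0#) → ∑ f ≈ f i
    ∑-single zero    f≈0 = trans (+-congˡ (∑-≈0 λ j → f≈0 (suc j) λ ())) (+-identityʳ _)
    ∑-single (suc i) f≈0 = trans (+-congʳ (f≈0 zero λ ())) (trans (+-identityˡ _)
      (∑-single i λ j j≢i → f≈0 (suc j) (j≢i ∘ Fin.suc-injective)))

    ∑-pair : ∀ {n} {f : Fin n → Carrier} {i j} → i ≢ j →
             (∀ k → k ≢ i → k ≢ j → f k ≈ 0#) → ∑ f ≈ f i + f j
    ∑-pair {i = zero} {zero} i≢j f≈0 = contradiction ≡.refl i≢j
    ∑-pair {i = zero} {suc j} i≢j f≈0 =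
      +-congˡ (∑-single j λ k k≢j → f≈0 (suc k) (λ ()) (k≢j ∘ Fin.suc-injective))
    ∑-pair {i = suc i} {zero} i≢j f≈0 = trans
      (+-congˡ (∑-single i λ k k≢i → f≈0 (suc k) (k≢i ∘ Fin.suc-injective) (λ ()))) (+-comm _ _)
    ∑-pair {i = suc i} {suc j} i≢j f≈0 = trans (+-congʳ (f≈0 zero (λ ()) (λ ()))) (trans (+-identityˡ _)
      (∑-pair (i≢j ∘ ≡.cong suc) λ k k≢i k≢j →
        f≈0 (suc k) (k≢i ∘ Fin.suc-injective) (k≢j ∘ Fin.suc-injective)))

    ∑-↑ : ∀ m {n} {f : Fin (m ℕ.+ n) → Carrier} →
          ∑ f ≈ ∑ (λ i → f (i ↑ˡ n)) + ∑ (λ i → f (m ↑ʳ i))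
    ∑-↑ zero    = sym (+-identityˡ _)
    ∑-↑ (suc m) = trans (+-congˡ (∑-↑ m)) (sym (+-assoc _ _ _))

  ∑-minus : ∀ {n} {f g : Fin n → Carrier} → ∑ (λ i → f i - g i) ≈ ∑ f - ∑ g
  ∑-minus = trans ∑-+ (+-congˡ ∑-neg)

  -- Which entry is nonzero cannot be decided, so the witness exists only under double negation.
  someNonzero : ∀ {A : Set} {f : A → Carrier} → ¬ (∀ i → f i ≈ 0#) → ¬ ¬ (∃[ i ] ¬ (f i ≈ 0#))
  someNonzero f≉0 none = f≉0 λ i → ≈0-stable _ λ fi≉0 → none (i , fi≉0)

  Independent : ∀ {n} {Y : Set} → (Fin n → Y → Carrier) → Set
  Independent {n} v = (a : Fin n → Carrier) → (∀ y → ∑ (λ j → a j * v j y) ≈ 0#) → ∀ j → a j ≈ 0#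

  -- Gaussian elimination, one pivot at a time and without division.
  rows⇒columns : ∀ {n} {Y : Set} (v : Fin n → Y → Carrier) → Independent v →
                 ¬ ¬ (Σ (Fin n → Y) λ c → Independent (λ k j → v j (c k)))
  rows⇒columns {zero}  v indep none = none ((λ ()) , λ _ _ ())
  rows⇒columns {suc n} {Y} v indep none =
    someNonzero v₀≉0 λ (y₀ , pivot≉0) →
    rows⇒columns (eliminated y₀) (eliminated-independent y₀ pivot≉0) λ (c , c-indep) →
    none (y₀ ◂ c , columns-independent y₀ pivot≉0 c c-indep)
    where
    v₀≉0 : ¬ (∀ y → v zero y ≈ 0#)
    v₀≉0 v₀≈0 = 1≉0 (indep (1# ◂ λ _ → 0#)
      (λ y → trans ∑-suc (+-≈0 (y≈0⇒xy≈0 1# (v₀≈0 y)) (∑-≈0 λ j → zeroˡ (v (suc j) y)))) zero)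

    eliminated : Y → Fin n → Y → Carrier
    eliminated y₀ j y = v zero y₀ * v (suc j) y - v (suc j) y₀ * v zero y

    eliminated-independent : ∀ y₀ → ¬ (v zero y₀ ≈ 0#) → Independent (eliminated y₀)
    eliminated-independent y₀ pivot≉0 a a-rel j =
      -- Expanding the eliminated vectors turns their relation `a` into one between the original
      -- vectors: `p * a j` on the later ones, and `- s` collecting the multiples of the first.
      noZeroDivisors _ _ pivot≉0 (indep (- s ◂ λ j → p * a j) b-rel (suc j))
      where
      p = v zero y₀
      s = ∑ (λ j → a j * v (suc j) y₀)
      b-rel : ∀ y → ∑ (λ j → (- s ◂ λ j → p * a j) j * v j y) ≈ 0#
      b-rel y = let x = v zero y in begin
        ∑ (λ j → (- s ◂ λ j → p * a j) j * v j y)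
          ≈⟨ ∑-suc ⟩
        - s * x + ∑ (λ j → p * a j * v (suc j) y)
          ≈⟨ solve 3 (λ s x z → (:- s) :* x :+ z := z :- x :* s) refl s x _ ⟩
        ∑ (λ j → p * a j * v (suc j) y) - x * s
          ≈⟨ +-congˡ (-‿cong (*-∑ x)) ⟩
        ∑ (λ j → p * a j * v (suc j) y) - ∑ (λ j → x * (a j * v (suc j) y₀))
          ≈⟨ ∑-minus ⟨
        ∑ (λ j → p * a j * v (suc j) y - x * (a j * v (suc j) y₀))
          ≈⟨ ∑-cong (λ j → solve 5 (λ p a w w₀ x →
               p :* a :* w :- x :* (a :* w₀) := a :* (p :* w :- w₀ :* x)) refl
               p (a j) (v (suc j) y) (v (suc j) y₀) x) ⟩
        ∑ (λ j → a j * eliminated y₀ j y)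
          ≈⟨ a-rel y ⟩
        0# ∎

    columns-independent : ∀ y₀ → ¬ (v zero y₀ ≈ 0#) → ∀ c → Independent (λ k j → eliminated y₀ j (c k)) →
                          Independent (λ k j → v j ((y₀ ◂ c) k))
    columns-independent y₀ pivot≉0 c c-indep b b-rel = λ { zero → b₀≈0 ; (suc k) → b≈0 k }
      where
      p = v zero y₀
      b≈0 : ∀ k → b (suc k) ≈ 0#
      -- Take `p` times the relation at the vector `suc j` minus `w₀` times the one at `zero`: the
      -- contribution of the column `y₀` cancels.
      b≈0 = c-indep (b ∘ suc) λ j → let w₀ = v (suc j) y₀ in begin
        ∑ (λ k → b (suc k) * eliminated y₀ j (c k))
          ≈⟨ ∑-cong (λ k → solve 5 (λ b p w w₀ x → b :* (p :* w :- w₀ :* x) :=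
               p :* (b :* w) :- w₀ :* (b :* x)) refl (b (suc k)) p (v (suc j) (c k)) w₀ (v zero (c k))) ⟩
        ∑ (λ k → p * (b (suc k) * v (suc j) (c k)) - w₀ * (b (suc k) * v zero (c k)))
          ≈⟨ ∑-minus ⟩
        ∑ (λ k → p * (b (suc k) * v (suc j) (c k))) - ∑ (λ k → w₀ * (b (suc k) * v zero (c k)))
          ≈⟨ +-cong (*-∑ p) (-‿cong (*-∑ w₀)) ⟨
        p * ∑ (λ k → b (suc k) * v (suc j) (c k)) - w₀ * ∑ (λ k → b (suc k) * v zero (c k))
          ≈⟨ solve 5 (λ p w₀ b₀ s s₀ → p :* s :- w₀ :* s₀ :=
               p :* (b₀ :* w₀ :+ s) :- w₀ :* (b₀ :* p :+ s₀)) refl p w₀ (b zero) _ _ ⟩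
        p * (b zero * w₀ + ∑ (λ k → b (suc k) * v (suc j) (c k))) -
        w₀ * (b zero * p + ∑ (λ k → b (suc k) * v zero (c k)))
          ≈⟨ +-≈0 (y≈0⇒xy≈0 p (trans (sym ∑-suc) (b-rel (suc j))))
                  (-‿≈0 (y≈0⇒xy≈0 w₀ (trans (sym ∑-suc) (b-rel zero)))) ⟩
        0# ∎
      b₀≈0 : b zero ≈ 0#
      b₀≈0 = noZeroDivisors _ _ pivot≉0 (begin
        p * b zero                                       ≈⟨ *-comm _ _ ⟩
        b zero * p                                       ≈⟨ ∑-single zero (λ
          { zero 0≢0 → contradiction ≡.refl 0≢0 ; (suc k) _ → x≈0⇒xy≈0 _ (b≈0 k) }) ⟨
        ∑ (λ k → b k * v zero ((y₀ ◂ c) k))              ≈⟨ b-rel zero ⟩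
        0#                                               ∎)

  δ : ∀ {n} → Fin n → Fin n → Carrier
  δ i j = if does (i Fin.≟ j) then 1# else 0#

  δ-≡ : ∀ {n} (i : Fin n) → δ i i ≈ 1#
  δ-≡ i with i Fin.≟ i
  ... | yes _  = refl
  ... | no i≢i = contradiction ≡.refl i≢i

  δ-≢ : ∀ {n} {i j : Fin n} → j ≢ i → δ i j ≈ 0#
  δ-≢ {i = i} {j} j≢i with i Fin.≟ j
  ... | yes i≡j = contradiction (≡.sym i≡j) j≢i
  ... | no _    = refl

  -- A repeated member would give the relation vᵢ − vⱼ = 0.
  independent⇒injective : ∀ {n} {Y Z : Set} (w : Z → Y → Carrier) (c : Fin n → Z) →
                          Independent (w ∘ c) → ∀ {i j} → c i ≡ c j → i ≡ j
  independent⇒injective w c indep {i} {j} ci≡cj with i Fin.≟ j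
  ... | yes i≡j = i≡j
  ... | no i≢j  = contradiction
    (trans (sym (trans (+-cong (δ-≡ i) (-‿≈0 (δ-≢ i≢j))) (+-identityʳ 1#)))
      (indep (λ k → δ i k - δ j k) relation i)) 1≉0
    where
    relation : ∀ y → ∑ (λ k → (δ i k - δ j k) * w (c k) y) ≈ 0#
    relation y = begin
      ∑ (λ k → (δ i k - δ j k) * w (c k) y)
        ≈⟨ ∑-pair i≢j (λ k k≢i k≢j → x≈0⇒xy≈0 _ (+-≈0 (δ-≢ k≢i) (-‿≈0 (δ-≢ k≢j)))) ⟩
      (δ i i - δ j i) * w (c i) y + (δ i j - δ j j) * w (c j) y
        ≈⟨ +-cong (*-congʳ (+-cong (δ-≡ i) (-‿cong (δ-≢ i≢j))))
             (*-cong (+-cong (δ-≢ (i≢j ∘ ≡.sym)) (-‿cong (δ-≡ j))) (reflexive (≡.cong (λ z → w z y) (≡.sym ci≡cj)))) ⟩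
      (1# - 0#) * w (c i) y + (0# - 1#) * w (c i) y
        ≈⟨ solve 1 (λ x → (con (+ 1) :- con (+ 0)) :* x :+ (con (+ 0) :- con (+ 1)) :* x := con (+ 0)) refl (w (c i) y) ⟩
      0# ∎

  -- The members of `Fin s` picked out by `rows⇒columns` are distinct, because a repetition is a
  -- dependence. The bound is decidable, so it can be extracted from the double negation.
  independent⇒≤ : ∀ {n s} (v : Fin n → Fin s → Carrier) → Independent v → n ℕ.≤ s
  independent⇒≤ {n} {s} v indep = decidable-stable (n ℕ.≤? s) λ n≰s →
    rows⇒columns v indep λ (c , c-indep) →
    n≰s (Fin.injective⇒≤ (independent⇒injective (λ y j → v j y) c c-indep))

  -- Functionals supported on finitely many points

  infix 8 _⟪$⟫_

  -- A formal linear combination of points; when the points are column indices, applying it to each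
  -- row yields the corresponding combination of columns.
  record Functional (Y : Set) : Set where
    constructor functional
    field
      {size}      : ℕ
      coefficient : Fin size → Carrier
      point       : Fin size → Y

  open Functional public

  opaque

    _⟪$⟫_ : ∀ {Y} → Functional Y → (Y → Carrier) → Carrier
    x ⟪$⟫ v = ∑ (λ k → coefficient x k * v (point x k))

    $≡∑ : ∀ {Y} (x : Functional Y) {v} → x ⟪$⟫ v ≡ ∑ (λ k → coefficient x k * v (point x k))
    $≡∑ x = ≡.refl

    evaluation : ∀ {Y} → Y → Functional Y
    evaluation y = functional {size = 1} (λ _ → 1#) (λ _ → y)

    evaluation-$ : ∀ {Y} (y : Y) v → evaluation y ⟪$⟫ v ≈ v y
    evaluation-$ y v = trans (∑-single zero λ { zero 0≢0 → contradiction ≡.refl 0≢0 ; (suc ()) }) (*-identityˡ _)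

    $-≈0 : ∀ {Y} (x : Functional Y) {v} → (∀ y → v y ≈ 0#) → x ⟪$⟫ v ≈ 0#
    $-≈0 x v≈0 = ∑-≈0 λ k → y≈0⇒xy≈0 _ (v≈0 _)

    $-cong : ∀ {Y} (x : Functional Y) {v w} → (∀ y → v y ≈ w y) → x ⟪$⟫ v ≈ x ⟪$⟫ w
    $-cong x v≈w = ∑-cong λ k → *-congˡ (v≈w _)

    $-* : ∀ {Y} (x : Functional Y) a {v} → x ⟪$⟫ (λ y → a * v y) ≈ a * x ⟪$⟫ v
    $-* x a {v} = trans (∑-cong λ k → solve 3 (λ c a w → c :* (a :* w) := a :* (c :* w)) refl
      (coefficient x k) a (v (point x k))) (sym (*-∑ a))

    $-∑ : ∀ {Y} (x : Functional Y) {n} {v : Fin n → Y → Carrier} →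
          x ⟪$⟫ (λ y → ∑ (λ j → v j y)) ≈ ∑ (λ j → x ⟪$⟫ v j)
    $-∑ x = trans (∑-cong λ k → *-∑ _) ∑-swap

    $-minus : ∀ {Y} (x : Functional Y) {v w} → x ⟪$⟫ (λ y → v y - w y) ≈ x ⟪$⟫ v - x ⟪$⟫ w
    $-minus x = trans (∑-cong λ k → x[y-z]≈xy-xz _ _ _) ∑-minus

    -- Restrict to as many independent columns as there are vectors. Without the vector at `i` there
    -- are more columns than coordinates, hence a nontrivial relation between the columns. As a
    -- functional it kills the other vectors; it cannot kill the one at `i` as well, since the
    -- columns are independent. The result serves as a dual basis, up to scale.
    separating : ∀ {n} {Y : Set} (v : Fin n → Y → Carrier) → Independent v → ∀ i →
                 ¬ ¬ (Σ (Functional Y) λ x → ¬ (x ⟪$⟫ v i ≈ 0#) × (∀ j → j ≢ i → x ⟪$⟫ v j ≈ 0#))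
    separating {suc n} v indep i none =
      rows⇒columns v indep λ (c , c-indep) →
      ℕ.<⇒≱ (ℕ.n<1+n n) (independent⇒≤ (λ k j → v (punchIn i j) (c k)) λ a a-rel k →
      ≈0-stable _ λ aₖ≉0 → none (functional a c
        , (λ aᵢ≈0 → aₖ≉0 (c-indep a (kills-all a c a-rel aᵢ≈0) k))
        , λ j j≢i → kills-others a c a-rel j j≢i))
      where
      kills-others : ∀ (a : Fin (suc n) → Carrier) c → (∀ j → functional a c ⟪$⟫ v (punchIn i j) ≈ 0#) →
                     ∀ j → j ≢ i → functional a c ⟪$⟫ v j ≈ 0#
      kills-others a c a-rel j j≢i = ≡.subst (λ j → functional a c ⟪$⟫ v j ≈ 0#)
        (Fin.punchIn-punchOut (j≢i ∘ ≡.sym)) (a-rel _)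
      kills-all : ∀ (a : Fin (suc n) → Carrier) c → (∀ j → functional a c ⟪$⟫ v (punchIn i j) ≈ 0#) →
                  functional a c ⟪$⟫ v i ≈ 0# → ∀ j → functional a c ⟪$⟫ v j ≈ 0#
      kills-all a c a-rel vᵢ≈0 j with j Fin.≟ i
      ... | yes ≡.refl = vᵢ≈0
      ... | no j≢i     = kills-others a c a-rel j j≢i

-- Bitstrings

private variable
  n : ℕ

⊕-comm : (σ τ : BitString n) → σ ⊕ τ ≡ τ ⊕ σ
⊕-comm = Vec.zipWith-comm Bool.xor-comm

⊕-assoc : (σ τ υ : BitString n) → (σ ⊕ τ) ⊕ υ ≡ σ ⊕ (τ ⊕ υ)
⊕-assoc = Vec.zipWith-assoc Bool.xor-assoc

⊕-cancelʳ : (σ τ : BitString n) → (σ ⊕ τ) ⊕ τ ≡ σ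
⊕-cancelʳ []      []      = ≡.refl
⊕-cancelʳ (b ∷ σ) (c ∷ τ) = ≡.cong₂ _∷_
  (≡.trans (Bool.xor-assoc b c c) (≡.trans (≡.cong (b xor_) (Bool.xor-same c)) (Bool.xor-identityʳ b)))
  (⊕-cancelʳ σ τ)

⊕-swapʳ : (σ τ υ : BitString n) → (σ ⊕ τ) ⊕ υ ≡ (σ ⊕ υ) ⊕ τ
⊕-swapʳ σ τ υ = ≡.trans (⊕-assoc σ τ υ) (≡.trans (≡.cong (σ ⊕_) (⊕-comm τ υ)) (≡.sym (⊕-assoc σ υ τ)))

⊕-flip² : (σ τ υ : BitString n) → (σ ⊕ υ) ⊕ (τ ⊕ υ) ≡ σ ⊕ τ
⊕-flip² σ τ υ = begin
  (σ ⊕ υ) ⊕ (τ ⊕ υ)   ≡⟨ ⊕-assoc (σ ⊕ υ) τ υ ⟨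
  ((σ ⊕ υ) ⊕ τ) ⊕ υ   ≡⟨ ≡.cong (_⊕ υ) (⊕-swapʳ σ υ τ) ⟩
  ((σ ⊕ τ) ⊕ υ) ⊕ υ   ≡⟨ ⊕-cancelʳ (σ ⊕ τ) υ ⟩
  σ ⊕ τ               ∎
  where open ≡-Reasoning

lookup-⊕ : (σ τ : BitString n) (i : Fin n) → lookup (σ ⊕ τ) i ≡ lookup σ i xor lookup τ i
lookup-⊕ σ τ i = Vec.lookup-zipWith _xor_ i σ τ

lookup-ext : {σ τ : BitString n} → (∀ i → lookup σ i ≡ lookup τ i) → σ ≡ τ
lookup-ext {σ = []}    {[]}    eq = ≡.refl
lookup-ext {σ = b ∷ σ} {c ∷ τ} eq = ≡.cong₂ _∷_ (eq zero) (lookup-ext (eq ∘ suc))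

lookup-e-≡ : (p : Fin n) → lookup (e p) p ≡ true
lookup-e-≡ zero    = ≡.refl
lookup-e-≡ (suc p) = lookup-e-≡ p

lookup-⊥ : (i : Fin n) → lookup ⊥ i ≡ false
lookup-⊥ i = Vec.lookup-replicate i false

lookup-e-≢ : {p i : Fin n} → i ≢ p → lookup (e p) i ≡ false
lookup-e-≢ {p = zero}  {zero}  i≢p = contradiction ≡.refl i≢p
lookup-e-≢ {p = zero}  {suc i} i≢p = lookup-⊥ i
lookup-e-≢ {p = suc p} {zero}  i≢p = ≡.refl
lookup-e-≢ {p = suc p} {suc i} i≢p = lookup-e-≢ (i≢p ∘ ≡.cong suc)

lookup-flip-≡ : (σ : BitString n) (p : Fin n) → lookup (σ ⊕ e p) p ≡ not (lookup σ p)
lookup-flip-≡ σ p = ≡.trans (lookup-⊕ σ (e p) p)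
  (≡.trans (≡.cong (lookup σ p xor_) (lookup-e-≡ p)) (Bool.xor-comm (lookup σ p) true))

lookup-flip-≢ : (σ : BitString n) {p i : Fin n} → i ≢ p → lookup (σ ⊕ e p) i ≡ lookup σ i
lookup-flip-≢ σ {p} {i} i≢p = ≡.trans (lookup-⊕ σ (e p) i)
  (≡.trans (≡.cong (lookup σ i xor_) (lookup-e-≢ i≢p)) (Bool.xor-identityʳ (lookup σ i)))

⊕-⊥ : (σ : BitString n) → σ ⊕ ⊥ ≡ σ
⊕-⊥ = Vec.zipWith-identityʳ Bool.xor-identityʳ

wt-flip : (σ : BitString n) (p : Fin n) → lookup σ p ≡ true → wt σ ≡ suc (wt (σ ⊕ e p))
wt-flip (true  ∷ σ) zero    _  = ≡.cong (suc ∘ wt) (≡.sym (⊕-⊥ σ))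
wt-flip (true  ∷ σ) (suc p) eq = ≡.cong suc (wt-flip σ p eq)
wt-flip (false ∷ σ) (suc p) eq = wt-flip σ p eq

lookup≡true⇒0<wt : (σ : BitString n) (p : Fin n) → lookup σ p ≡ true → 0 ℕ.< wt σ
lookup≡true⇒0<wt σ p eq = ≡.subst (0 ℕ.<_) (≡.sym (wt-flip σ p eq)) (ℕ.s≤s ℕ.z≤n)

π : BitString n → Parity
π σ = parity (wt σ)

parity-suc : ∀ n → parity (suc n) ≡ parity n ℙ.⁻¹
parity-suc n = ≡.trans (≡.sym (ℙ.⁻¹-involutive _)) (≡.cong ℙ._⁻¹ (ℙ.suc-homo-⁻¹ n))

π-⊕ : (σ τ : BitString n) → π (σ ⊕ τ) ≡ π σ ℙ.+ π τ
π-⊕ []          []          = ≡.refl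
π-⊕ (false ∷ σ) (false ∷ τ) = π-⊕ σ τ
π-⊕ (false ∷ σ) (true ∷ τ)  = ≡.trans (parity-suc (wt (σ ⊕ τ))) (≡.trans (≡.cong ℙ._⁻¹ (π-⊕ σ τ))
  (≡.trans (shift (π σ) (π τ)) (≡.cong (π σ ℙ.+_) (≡.sym (parity-suc (wt τ))))))
  where
  shift : ∀ p q → (p ℙ.+ q) ℙ.⁻¹ ≡ p ℙ.+ (q ℙ.⁻¹)
  shift 0ℙ q  = ≡.refl
  shift 1ℙ q = ≡.refl
π-⊕ (true ∷ σ)  (false ∷ τ) = ≡.trans (parity-suc (wt (σ ⊕ τ))) (≡.trans (≡.cong ℙ._⁻¹ (π-⊕ σ τ))
  (≡.trans (≡.sym (ℙ.+-assoc 1ℙ (π σ) (π τ))) (≡.cong (ℙ._+ π τ) (≡.sym (parity-suc (wt σ))))))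
π-⊕ (true ∷ σ)  (true ∷ τ)  = ≡.trans (π-⊕ σ τ) (≡.trans (cancel (π σ) (π τ))
  (≡.cong₂ ℙ._+_ (≡.sym (parity-suc (wt σ))) (≡.sym (parity-suc (wt τ)))))
  where
  cancel : ∀ p q → p ℙ.+ q ≡ (p ℙ.⁻¹) ℙ.+ (q ℙ.⁻¹)
  cancel 0ℙ 0ℙ = ≡.refl
  cancel 0ℙ 1ℙ = ≡.refl
  cancel 1ℙ 0ℙ = ≡.refl
  cancel 1ℙ 1ℙ = ≡.refl

π-flip : (σ : BitString n) (p : Fin n) → π (σ ⊕ e p) ≡ π σ ℙ.⁻¹
π-flip σ p = ≡.trans (π-⊕ σ (e p))
  (≡.trans (≡.cong (λ k → π σ ℙ.+ parity k) (∣⁅x⁆∣≡1 p)) (ℙ.+-comm (π σ) 1ℙ))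

π-flip-≡ : (σ τ : BitString n) (p q : Fin n) → π σ ≡ π τ → π (σ ⊕ e p) ≡ π (τ ⊕ e q)
π-flip-≡ σ τ p q eq = ≡.trans (π-flip σ p) (≡.trans (≡.cong ℙ._⁻¹ eq) (≡.sym (π-flip τ q)))

≢-⁻¹ : ∀ {p q} → p ≢ q → p ≡ q ℙ.⁻¹
≢-⁻¹ {0ℙ} {0ℙ} p≢q = contradiction ≡.refl p≢q
≢-⁻¹ {0ℙ} {1ℙ} p≢q = ≡.refl
≢-⁻¹ {1ℙ} {0ℙ} p≢q = ≡.refl
≢-⁻¹ {1ℙ} {1ℙ} p≢q = contradiction ≡.refl p≢q

π-≡⇒⊕≡0 : (σ τ : BitString n) → π σ ≡ π τ → π (σ ⊕ τ) ≡ 0ℙ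
π-≡⇒⊕≡0 σ τ eq = ≡.trans (π-⊕ σ τ) (≡.trans (≡.cong (ℙ._+ π τ) eq) (ℙ.p+p≡0ℙ (π τ)))

xor-≢ : ∀ {b c} → b ≢ c → b xor c ≡ true
xor-≢ {false} {false} ne = contradiction ≡.refl ne
xor-≢ {false} {true}  _  = ≡.refl
xor-≢ {true}  {false} _  = ≡.refl
xor-≢ {true}  {true}  ne = contradiction ≡.refl ne

⊕-≢⇒true : (σ τ : BitString n) (i : Fin n) → lookup σ i ≢ lookup τ i → lookup (σ ⊕ τ) i ≡ true
⊕-≢⇒true σ τ i ne = ≡.trans (lookup-⊕ σ τ i) (xor-≢ ne)

⊕-≡⇒false : (σ τ : BitString n) (i : Fin n) → lookup σ i ≡ lookup τ i → lookup (σ ⊕ τ) i ≡ false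
⊕-≡⇒false σ τ i eq = ≡.trans (lookup-⊕ σ τ i)
  (≡.trans (≡.cong (_xor lookup τ i) eq) (Bool.xor-same (lookup τ i)))

⊕-≢true⇒≡ : (σ τ : BitString n) (i : Fin n) → lookup (σ ⊕ τ) i ≢ true → lookup σ i ≡ lookup τ i
⊕-≢true⇒≡ σ τ i ne with lookup σ i Bool.≟ lookup τ i
... | yes eq = eq
... | no ne′ = contradiction (⊕-≢⇒true σ τ i ne′) ne

-- Matchgate identities

-- Row-side coefficients t absorb the signs δ, column-side coefficients u the
-- signs ε; the shift by e p₁ of the informal identities is undone.
record MatchgateIdentities (D : StableDomain) (ℓ m : ℕ) : Set where
  open StableDomain D
  open LinearAlgebra D
  field
    Γ           : BitString ℓ → BitString m → Carrier
    homogeneous : ∀ σ τ ζ → ¬ (Γ σ ζ ≈ 0#) → ¬ (Γ τ ζ ≈ 0#) → π σ ≡ π τ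
    t           : BitString ℓ → BitString ℓ → Fin ℓ → Carrier
    t-off       : ∀ α β p → lookup (α ⊕ β) p ≡ false → t α β p ≈ 0#
    t-on        : ∀ α β p → π α ≡ π β → lookup (α ⊕ β) p ≡ true → ¬ (t α β p ≈ 0#)
    t-pair      : ∀ α β {p q} → p ≢ q → α ⊕ β ≡ e p ⊕ e q → t α β p ≈ - t α β q
    u           : BitString m → BitString m → Fin m → Carrier
    u-sym       : ∀ ζ η q → u ζ η q ≈ u η ζ q
    identity    : ∀ α β → α ≢ β → π α ≡ π β → ∀ ζ η →
                  ∑ (λ p → t α β p * (Γ (α ⊕ e p) ζ * Γ (β ⊕ e p) η)) ≈
                  ∑ (λ q → u ζ η q * (Γ α (ζ ⊕ e q) * Γ β (η ⊕ e q)))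

-- Forms annihilated by relations between rows

module Rigidity (D : StableDomain) {ℓ m : ℕ} (G : MatchgateIdentities D ℓ m) where

  open StableDomain D
  open LinearAlgebra D
  open MatchgateIdentities G
  open SetoidReasoning setoid
  open IntegerSolver ring using (solve; _:=_; _:*_; _:-_)

  infix 9 _⟨_⟩
  _⟨_⟩ : Functional (BitString m) → BitString ℓ → Carrier
  x ⟨ τ ⟩ = x ⟪$⟫ Γ τ

  Relation : ∀ {n} → (Fin n → Carrier) → (Fin n → BitString ℓ) → Set
  Relation c ρ = ∀ ζ → ∑ (λ j → c j * Γ (ρ j) ζ) ≈ 0#

  -- The identities only compare rows of equal parity, so the coefficients of rows whose parity
  -- differs from that of `β` are set to zero.
  restrict : ∀ {n} → BitString ℓ → (Fin n → BitString ℓ) → (Fin n → Carrier) → Fin n → Carrier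
  restrict β ρ c j = if does (π β ℙ.≟ π (ρ j)) then c j else 0#

  restrict-≡ : ∀ {n} β (ρ : Fin n → BitString ℓ) c j → π β ≡ π (ρ j) → restrict β ρ c j ≈ c j
  restrict-≡ β ρ c j eq with π β ℙ.≟ π (ρ j)
  ... | yes _ = refl
  ... | no ne = contradiction eq ne

  restrict-≢ : ∀ {n} β (ρ : Fin n → BitString ℓ) c j → π β ≢ π (ρ j) → restrict β ρ c j ≈ 0#
  restrict-≢ β ρ c j ne with π β ℙ.≟ π (ρ j)
  ... | yes eq = contradiction eq ne
  ... | no _   = refl

  -- Each column is supported on rows of one parity, so at each column the
  -- restricted sum is either the whole sum or has no nonzero term.
  restrict-relation : ∀ {n} β (ρ : Fin n → BitString ℓ) c → Relation c ρ → Relation (restrict β ρ c) ρ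
  restrict-relation β ρ c rel ζ = ≈0-stable _ λ sum≉0 →
    someNonzero (sum≉0 ∘ ∑-≈0) λ (i , term≉0) → sum≉0 (trans (∑-cong (unrestricted i term≉0)) (rel ζ))
    where
    unrestricted : ∀ i → ¬ (restrict β ρ c i * Γ (ρ i) ζ ≈ 0#) →
                   ∀ j → restrict β ρ c j * Γ (ρ j) ζ ≈ c j * Γ (ρ j) ζ
    unrestricted i term≉0 j with π β ℙ.≟ π (ρ j) | π β ℙ.≟ π (ρ i)
    ... | yes _ | _      = refl
    ... | no _  | no _   = contradiction (zeroˡ _) term≉0
    ... | no ne | yes eq = trans (zeroˡ _) (sym (y≈0⇒xy≈0 _ (≈0-stable _ λ Γ≉0 →
      ne (≡.trans eq (homogeneous (ρ i) (ρ j) ζ (λ Γ≈0 → term≉0 (y≈0⇒xy≈0 _ Γ≈0)) Γ≉0)))))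

  -- The row side of the identity for `β` and `τ`, extended bilinearly from pairs of columns to
  -- pairs of functionals.
  rowForm : BitString ℓ → BitString ℓ → Functional (BitString m) → Functional (BitString m) → Carrier
  rowForm β τ x y = ∑ (λ p → t β τ p * (x ⟨ β ⊕ e p ⟩ * y ⟨ τ ⊕ e p ⟩))

  private
    entryForm columnForm : BitString ℓ → BitString ℓ → BitString m → BitString m → Carrier
    entryForm  β τ ζ η = ∑ (λ p → t β τ p * (Γ (β ⊕ e p) ζ * Γ (τ ⊕ e p) η))
    columnForm β τ ζ η = ∑ (λ q → u ζ η q * (Γ β (ζ ⊕ e q) * Γ τ (η ⊕ e q)))

    -- Each summand is a product of a factor in `ζ` and a factor in `η`, so the two functionals can
    -- be applied separately.
    lift : ∀ {n} (x y : Functional (BitString m)) (s : Fin n → Carrier) (g h : Fin n → BitString m → Carrier) →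
           x ⟪$⟫ (λ ζ → y ⟪$⟫ (λ η → ∑ (λ p → s p * (g p ζ * h p η)))) ≈
           ∑ (λ p → s p * (x ⟪$⟫ g p * y ⟪$⟫ h p))
    lift x y s g h = begin
      x ⟪$⟫ (λ ζ → y ⟪$⟫ (λ η → ∑ (λ p → s p * (g p ζ * h p η))))
        ≈⟨ $-cong x (λ ζ → trans ($-∑ y) (∑-cong λ p → trans ($-* y (s p)) (*-congˡ ($-* y (g p ζ))))) ⟩
      x ⟪$⟫ (λ ζ → ∑ (λ p → s p * (g p ζ * y ⟪$⟫ h p)))
        ≈⟨ trans ($-∑ x) (∑-cong λ p → trans ($-* x (s p))
             (*-congˡ (trans ($-cong x λ ζ → *-comm _ _) (trans ($-* x _) (*-comm _ _))))) ⟩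
      ∑ (λ p → s p * (x ⟪$⟫ g p * y ⟪$⟫ h p)) ∎

    -- The coefficients `u` do not depend on the rows and the second row enters linearly, so a
    -- relation between rows annihilates the column sides.
    columnForm-relation : ∀ {n} β (ρ : Fin n → BitString ℓ) c → Relation c ρ → ∀ ζ η →
                          ∑ (λ j → c j * columnForm β (ρ j) ζ η) ≈ 0#
    columnForm-relation β ρ c rel ζ η = begin
      ∑ (λ j → c j * columnForm β (ρ j) ζ η)
        ≈⟨ ∑-cong (λ j → *-∑ (c j)) ⟩
      ∑ (λ j → ∑ (λ q → c j * (u ζ η q * (Γ β (ζ ⊕ e q) * Γ (ρ j) (η ⊕ e q)))))
        ≈⟨ ∑-swap ⟩
      ∑ (λ q → ∑ (λ j → c j * (u ζ η q * (Γ β (ζ ⊕ e q) * Γ (ρ j) (η ⊕ e q)))))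
        ≈⟨ ∑-≈0 (λ q → let k = u ζ η q * Γ β (ζ ⊕ e q) in trans
             (∑-cong λ j → solve 4 (λ c u a b → c :* (u :* (a :* b)) := u :* a :* (c :* b)) refl
               (c j) (u ζ η q) (Γ β (ζ ⊕ e q)) (Γ (ρ j) (η ⊕ e q)))
             (trans (sym (*-∑ k)) (y≈0⇒xy≈0 k (rel (η ⊕ e q))))) ⟩
      0# ∎

    lift-relation : ∀ {n} (c : Fin n → Carrier) (F : Fin n → BitString m → BitString m → Carrier) x y →
                    (∀ ζ η → ∑ (λ j → c j * F j ζ η) ≈ 0#) →
                    ∑ (λ j → c j * x ⟪$⟫ (λ ζ → y ⟪$⟫ (λ η → F j ζ η))) ≈ 0#
    lift-relation c F x y F≈0 = begin
      ∑ (λ j → c j * x ⟪$⟫ (λ ζ → y ⟪$⟫ (λ η → F j ζ η)))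
        ≈⟨ ∑-cong (λ j → trans ($-cong x λ ζ → $-* y (c j)) ($-* x (c j))) ⟨
      ∑ (λ j → x ⟪$⟫ (λ ζ → y ⟪$⟫ (λ η → c j * F j ζ η)))
        ≈⟨ trans ($-cong x λ ζ → $-∑ y) ($-∑ x) ⟨
      x ⟪$⟫ (λ ζ → y ⟪$⟫ (λ η → ∑ (λ j → c j * F j ζ η)))
        ≈⟨ $-≈0 x (λ ζ → $-≈0 y (F≈0 ζ)) ⟩
      0# ∎

    columnForm-sym : ∀ β ζ η → columnForm β β ζ η ≈ columnForm β β η ζ
    columnForm-sym β ζ η = ∑-cong λ q → *-cong (u-sym ζ η q) (*-comm _ _)

    entryForm-diagonal : ∀ β ζ η → entryForm β β ζ η ≈ 0#
    entryForm-diagonal β ζ η = ∑-≈0 λ p → x≈0⇒xy≈0 _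
      (t-off β β p (≡.trans (lookup-⊕ β β p) (Bool.xor-same (lookup β p))))

  -- Since `β` differs from every `ρ j`, each retained row side may be replaced by its column side,
  -- which the relation annihilates.
  rowForm-relation : ∀ {n} β (ρ : Fin n → BitString ℓ) c → Relation c ρ → (∀ j → β ≢ ρ j) → ∀ x y →
                     ∑ (λ j → restrict β ρ c j * rowForm β (ρ j) x y) ≈ 0#
  rowForm-relation β ρ c rel β∉ρ x y = begin
    ∑ (λ j → restrict β ρ c j * rowForm β (ρ j) x y)
      ≈⟨ ∑-cong (λ j → *-congˡ (lift x y _ _ _)) ⟨
    ∑ (λ j → restrict β ρ c j * x ⟪$⟫ (λ ζ → y ⟪$⟫ (λ η → entryForm β (ρ j) ζ η)))
      ≈⟨ lift-relation (restrict β ρ c) (λ j → entryForm β (ρ j)) x y entries ⟩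
    0# ∎
    where
    entries : ∀ ζ η → ∑ (λ j → restrict β ρ c j * entryForm β (ρ j) ζ η) ≈ 0#
    entries ζ η = trans (∑-cong by-identity) (columnForm-relation β ρ _ (restrict-relation β ρ c rel) ζ η)
      where
      by-identity : ∀ j → restrict β ρ c j * entryForm β (ρ j) ζ η ≈ restrict β ρ c j * columnForm β (ρ j) ζ η
      by-identity j with π β ℙ.≟ π (ρ j)
      ... | yes eq = *-congˡ (identity β (ρ j) (β∉ρ j) eq ζ η)
      ... | no _   = trans (zeroˡ _) (sym (zeroˡ _))

  -- The 2 × 2 determinant of the values of `x` and `y` on two rows; its vanishing for all `x` and
  -- `y` expresses that the rows are linearly dependent.
  minor : Functional (BitString m) → Functional (BitString m) → BitString ℓ → BitString ℓ → Carrier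
  minor x y σ τ = x ⟨ σ ⟩ * y ⟨ τ ⟩ - y ⟨ σ ⟩ * x ⟨ τ ⟩

  -- This is `rowForm β τ x y` minus `rowForm β τ y x`, collected termwise.
  alternatingForm : BitString ℓ → BitString ℓ → Functional (BitString m) → Functional (BitString m) → Carrier
  alternatingForm β τ x y = ∑ (λ p → t β τ p * minor x y (β ⊕ e p) (τ ⊕ e p))

  -- Antisymmetrising disposes of the term with ρ j ≡ β, where no identity is
  -- available: its column side is symmetric because u is.
  alternatingForm-relation : ∀ {n} β (ρ : Fin n → BitString ℓ) c → Relation c ρ → ∀ x y →
                             ∑ (λ j → restrict β ρ c j * alternatingForm β (ρ j) x y) ≈ 0#
  alternatingForm-relation β ρ c rel x y = begin
    ∑ (λ j → restrict β ρ c j * alternatingForm β (ρ j) x y)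
      ≈⟨ ∑-cong (λ j → *-congˡ (sym (trans ($-cong x λ ζ → $-minus y)
           (trans ($-minus x) (split β (ρ j)))))) ⟩
    ∑ (λ j → restrict β ρ c j * x ⟪$⟫ (λ ζ → y ⟪$⟫ (λ η → entryForm β (ρ j) ζ η - entryForm β (ρ j) η ζ)))
      ≈⟨ lift-relation (restrict β ρ c) _ x y entries ⟩
    0# ∎
    where
    split : ∀ β τ → x ⟪$⟫ (λ ζ → y ⟪$⟫ (λ η → entryForm β τ ζ η)) - x ⟪$⟫ (λ ζ → y ⟪$⟫ (λ η → entryForm β τ η ζ)) ≈
                    alternatingForm β τ x y
    split β τ = begin
      x ⟪$⟫ (λ ζ → y ⟪$⟫ (λ η → entryForm β τ ζ η)) - x ⟪$⟫ (λ ζ → y ⟪$⟫ (λ η → entryForm β τ η ζ))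
        ≈⟨ +-cong (lift x y _ _ _) (-‿cong (trans ($-cong x λ ζ → $-cong y λ η → ∑-cong λ p → *-congˡ (*-comm _ _))
             (lift x y _ _ _))) ⟩
      ∑ (λ p → t β τ p * (x ⟨ β ⊕ e p ⟩ * y ⟨ τ ⊕ e p ⟩)) - ∑ (λ p → t β τ p * (x ⟨ τ ⊕ e p ⟩ * y ⟨ β ⊕ e p ⟩))
        ≈⟨ ∑-minus ⟨
      ∑ (λ p → t β τ p * (x ⟨ β ⊕ e p ⟩ * y ⟨ τ ⊕ e p ⟩) - t β τ p * (x ⟨ τ ⊕ e p ⟩ * y ⟨ β ⊕ e p ⟩))
        ≈⟨ ∑-cong (λ p → solve 5 (λ t a b c d → t :* (a :* b) :- t :* (c :* d) := t :* (a :* b :- d :* c)) refl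
             (t β τ p) (x ⟨ β ⊕ e p ⟩) (y ⟨ τ ⊕ e p ⟩) (x ⟨ τ ⊕ e p ⟩) (y ⟨ β ⊕ e p ⟩)) ⟩
      alternatingForm β τ x y ∎
    entries : ∀ ζ η → ∑ (λ j → restrict β ρ c j * (entryForm β (ρ j) ζ η - entryForm β (ρ j) η ζ)) ≈ 0#
    entries ζ η = begin
      ∑ (λ j → restrict β ρ c j * (entryForm β (ρ j) ζ η - entryForm β (ρ j) η ζ))
        ≈⟨ ∑-cong (λ j → trans (by-identity j) (x[y-z]≈xy-xz _ _ _)) ⟩
      ∑ (λ j → restrict β ρ c j * columnForm β (ρ j) ζ η - restrict β ρ c j * columnForm β (ρ j) η ζ)
        ≈⟨ ∑-minus ⟩
      ∑ (λ j → restrict β ρ c j * columnForm β (ρ j) ζ η) - ∑ (λ j → restrict β ρ c j * columnForm β (ρ j) η ζ)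
        ≈⟨ +-≈0 (columnForm-relation β ρ _ rel′ ζ η) (-‿≈0 (columnForm-relation β ρ _ rel′ η ζ)) ⟩
      0# ∎
      where
      rel′ = restrict-relation β ρ c rel
      by-identity : ∀ j → restrict β ρ c j * (entryForm β (ρ j) ζ η - entryForm β (ρ j) η ζ) ≈
                          restrict β ρ c j * (columnForm β (ρ j) ζ η - columnForm β (ρ j) η ζ)
      by-identity j with π β ℙ.≟ π (ρ j) | Vec.≡-dec Bool._≟_ β (ρ j)
      ... | no _   | _      = trans (zeroˡ _) (sym (zeroˡ _))
      ... | yes eq | no β≢ρ = *-congˡ (+-cong (identity β (ρ j) β≢ρ eq ζ η) (-‿cong (identity β (ρ j) β≢ρ eq η ζ)))
      ... | yes _  | yes β≡ρ = ≡.subst (λ τ → c j * (entryForm β τ ζ η - entryForm β τ η ζ) ≈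
                                             c j * (columnForm β τ ζ η - columnForm β τ η ζ)) β≡ρ
        (*-congˡ (trans (+-≈0 (entryForm-diagonal β ζ η) (-‿≈0 (entryForm-diagonal β η ζ)))
          (sym (trans (+-congʳ (columnForm-sym β ζ η)) (-‿inverseʳ _)))))

-- No two adjacent nonzero rows

module Isolated (D : StableDomain) {ℓ m : ℕ} (G : MatchgateIdentities D ℓ m) where

  open StableDomain D
  open LinearAlgebra D
  open MatchgateIdentities G
  open Rigidity D G
  open SetoidReasoning setoid
  open IntegerSolver ring using (solve; _:=_; _:+_; _:*_; :-_; _:-_; con)

  ZeroRow : BitString ℓ → Set
  ZeroRow τ = ∀ ζ → Γ τ ζ ≈ 0#

  -- `Spanning` is the dual formulation, in terms of functionals: no coefficients of an expansion
  -- have to be produced.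
  IndependentRows Spanning : ∀ {n} → (Fin n → BitString ℓ) → Set
  IndependentRows ρ = Independent (λ j → Γ (ρ j))
  Spanning ρ = ∀ x → (∀ j → x ⟨ ρ j ⟩ ≈ 0#) → ∀ τ → x ⟨ τ ⟩ ≈ 0#

  -- Restricting a relation to the parity of `ρ j` leaves the term of `ρ j` alone.
  distinct-parities : ∀ {n} {ρ : Fin n → BitString ℓ} → (∀ {i j} → i ≢ j → π (ρ i) ≢ π (ρ j)) →
                      (∀ j → ¬ ZeroRow (ρ j)) → IndependentRows ρ
  distinct-parities {ρ = ρ} distinct nonzero a rel j = ≈0-stable _ λ aⱼ≉0 →
    someNonzero (nonzero j) λ (ζ , Γ≉0) → *-≉0 aⱼ≉0 Γ≉0 (begin
      a j * Γ (ρ j) ζ                                     ≈⟨ *-congʳ (restrict-≡ (ρ j) ρ a j ≡.refl) ⟨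
      restrict (ρ j) ρ a j * Γ (ρ j) ζ                    ≈⟨ ∑-single j (λ i i≢j →
                                                               x≈0⇒xy≈0 _ (restrict-≢ (ρ j) ρ a i (distinct (i≢j ∘ ≡.sym)))) ⟨
      ∑ (λ i → restrict (ρ j) ρ a i * Γ (ρ i) ζ)          ≈⟨ restrict-relation (ρ j) ρ a rel ζ ⟩
      0#                                                  ∎)

  -- A zero row is a relation with one term, to which `alternatingForm-relation` applies.
  alternatingForm-zeroRow : ∀ {α β} → ZeroRow α → π β ≡ π α → ∀ x y → alternatingForm β α x y ≈ 0#
  alternatingForm-zeroRow {α} {β} zeroRow eq x y = begin
    alternatingForm β α x y                             ≈⟨ *-identityˡ _ ⟨
    1# * alternatingForm β α x y                        ≈⟨ *-congʳ (restrict-≡ {n = 1} β (λ _ → α) (λ _ → 1#) zero eq) ⟨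
    restrict {n = 1} β (λ _ → α) (λ _ → 1#) zero * alternatingForm β α x y
                                                        ≈⟨ ∑-single {n = 1} zero (λ { zero ne → contradiction ≡.refl ne ; (suc ()) }) ⟨
    ∑ {n = 1} (λ j → restrict β (λ _ → α) (λ _ → 1#) j * alternatingForm β α x y)
                                                        ≈⟨ alternatingForm-relation β (λ _ → α) (λ _ → 1#)
                                                             (λ ζ → ∑-≈0 λ _ → y≈0⇒xy≈0 _ (zeroRow ζ)) x y ⟩
    0#                                                  ∎

  minor≉0⇒¬zeroRow : ∀ x y σ τ → ¬ (minor x y σ τ ≈ 0#) → ¬ ZeroRow σ
  minor≉0⇒¬zeroRow x y σ τ minor≉0 zeroRow = minor≉0
    (+-≈0 (x≈0⇒xy≈0 _ ($-≈0 x zeroRow)) (-‿≈0 (x≈0⇒xy≈0 _ ($-≈0 y zeroRow))))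

  minor-antisym : ∀ x y σ τ → minor x y τ σ ≈ - minor x y σ τ
  minor-antisym x y σ τ = solve 4 (λ a b c d → a :* b :- c :* d := :- (d :* c :- b :* a)) refl
    (x ⟨ τ ⟩) (y ⟨ σ ⟩) (y ⟨ τ ⟩) (x ⟨ σ ⟩)

  module _ (isolated : ∀ α p → ¬ ZeroRow α → ZeroRow (α ⊕ e p)) where

    -- If the minor is nonzero then so is row `σ`, hence its neighbour `α` is zero. The form of `β`
    -- and `α` has two terms, at `p` and `q`; their coefficients are opposite and so are their
    -- minors, so the form equals twice `T * M`.
    minor-distance-2 : ∀ x y σ {p q} → p ≢ q → minor x y σ (σ ⊕ e p ⊕ e q) ≈ 0#
    minor-distance-2 x y σ {p} {q} p≢q = ≈0-stable _ λ M≉0 →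
      let α = σ ⊕ e p
          β = σ ⊕ e q
          τ = σ ⊕ e p ⊕ e q
          T = t β α q
          M = minor x y σ τ
          zeroRow = isolated σ p (minor≉0⇒¬zeroRow x y σ τ M≉0)
          same-parity = π-flip-≡ σ σ q p ≡.refl
          β⊕α : β ⊕ α ≡ e q ⊕ e p
          β⊕α = ≡.trans (≡.trans (≡.cong (_⊕ α) (⊕-comm σ (e q))) (≡.cong (e q ⊕ σ ⊕_) (⊕-comm σ (e p)))) (⊕-flip² (e q) (e p) σ)
          T≉0 = t-on β α q same-parity (≡.trans (≡.cong (λ υ → lookup υ q) β⊕α)
                  (≡.trans (≡.cong (λ υ → lookup υ q) (⊕-comm (e q) (e p)))
                    (≡.trans (lookup-flip-≡ (e p) q) (≡.cong not (lookup-e-≢ (p≢q ∘ ≡.sym))))))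
      in *-≉0 T≉0 M≉0 (x+x≈0⇒x≈0 (T * M) (begin
        T * M + T * M
          ≈⟨ +-congˡ (solve 2 (λ t m → t :* m := (:- t) :* (:- m)) refl T M) ⟩
        T * M + - T * - M
          ≈⟨ +-congˡ (*-cong (sym (t-pair β α (p≢q) (≡.trans β⊕α (⊕-comm (e q) (e p))))) (sym (minor-antisym x y σ τ))) ⟩
        T * M + t β α p * minor x y τ σ
          ≡⟨ ≡.cong₂ (λ υ ω → T * minor x y υ τ + t β α p * ω) (≡.sym (⊕-cancelʳ σ (e q)))
               (≡.cong₂ (minor x y) (⊕-swapʳ σ (e p) (e q)) (≡.sym (⊕-cancelʳ σ (e p)))) ⟩
        T * minor x y (β ⊕ e q) (α ⊕ e q) + t β α p * minor x y (β ⊕ e p) (α ⊕ e p)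
          ≈⟨ ∑-pair (p≢q ∘ ≡.sym) (λ k k≢q k≢p → x≈0⇒xy≈0 _ (t-off β α k
               (≡.trans (≡.cong (λ υ → lookup υ k) β⊕α) (≡.trans (lookup-flip-≢ (e q) k≢p) (lookup-e-≢ k≢q))))) ⟨
        alternatingForm β α x y
          ≈⟨ alternatingForm-zeroRow zeroRow same-parity x y ⟩
        0# ∎))

    -- A Plücker relation shows that proportionality of rows passes through the
    -- intermediate row ρ.
    minor-product : ∀ x y σ τ ρ κ → minor x y σ ρ ≈ 0# → minor x y τ ρ ≈ 0# → minor x y σ τ * minor x y ρ κ ≈ 0#
    minor-product x y σ τ ρ κ σρ≈0 τρ≈0 = begin
      minor x y σ τ * minor x y ρ κ
        ≈⟨ solve 8 (λ xσ yσ xτ yτ xρ yρ xκ yκ →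
             (xσ :* yτ :- yσ :* xτ) :* (xρ :* yκ :- yρ :* xκ) :=
             (yκ :* xτ :- xκ :* yτ) :* (xσ :* yρ :- yσ :* xρ) :+
             (xκ :* yσ :- yκ :* xσ) :* (xτ :* yρ :- yτ :* xρ)) refl
             (x ⟨ σ ⟩) (y ⟨ σ ⟩) (x ⟨ τ ⟩) (y ⟨ τ ⟩) (x ⟨ ρ ⟩) (y ⟨ ρ ⟩) (x ⟨ κ ⟩) (y ⟨ κ ⟩) ⟩
      _ * minor x y σ ρ + _ * minor x y τ ρ
        ≈⟨ +-≈0 (y≈0⇒xy≈0 _ σρ≈0) (y≈0⇒xy≈0 _ τρ≈0) ⟩
      0# ∎

    -- Induction on the Hamming distance. A nonzero minor `M` makes row `σ ⊕ e p` zero, so the form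
    -- of `τ ⊕ e p` and `σ ⊕ e p` vanishes. After multiplication by `M`, the term at any other
    -- differing position `q` dies by `minor-product`, through the row `τ ⊕ e p ⊕ e q`; what is left
    -- is a nonzero multiple of `M * M`.
    proportional : ∀ x y n σ τ → π σ ≡ π τ → wt (σ ⊕ τ) ℕ.≤ n → minor x y σ τ ≈ 0#
    proportional x y n σ τ same-parity wt≤n with Fin.any? (λ p → lookup (σ ⊕ τ) p Bool.≟ true)
    ... | no none rewrite lookup-ext {σ = σ} {τ} (λ i → ⊕-≢true⇒≡ σ τ i (λ eq → none (i , eq))) =
      solve 2 (λ a b → a :* b :- b :* a := con (+ 0)) refl (x ⟨ τ ⟩) (y ⟨ τ ⟩)
    proportional x y zero σ τ same-parity wt≤n | yes (p , p∈) =
      contradiction (lookup≡true⇒0<wt (σ ⊕ τ) p p∈) (ℕ.≤⇒≯ wt≤n)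
    proportional x y (suc n) σ τ same-parity wt≤n | yes (p , p∈) = ≈0-stable _ λ M≉0 →
      let α = σ ⊕ e p
          β = τ ⊕ e p
          M = minor x y σ τ
          T = t β α p
          zeroRow = isolated σ p (minor≉0⇒¬zeroRow x y σ τ M≉0)
          β⊕α : β ⊕ α ≡ σ ⊕ τ
          β⊕α = ≡.trans (⊕-flip² τ σ (e p)) (⊕-comm τ σ)
          βα-parity = π-flip-≡ τ σ p p (≡.sym same-parity)
          T≉0 = t-on β α p βα-parity (≡.trans (≡.cong (λ υ → lookup υ p) β⊕α) p∈)
      in *-≉0 T≉0 (*-≉0 M≉0 M≉0) (begin
        T * (M * M)
          ≈⟨ solve 2 (λ t m → t :* (m :* m) := :- (m :* (t :* (:- m)))) refl T M ⟩
        - (M * (T * - M))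
          ≈⟨ -‿cong (*-congˡ (*-congˡ (minor-antisym x y σ τ))) ⟨
        - (M * (T * minor x y τ σ))
          ≡⟨ ≡.cong₂ (λ υ ω → - (M * (T * minor x y υ ω))) (≡.sym (⊕-cancelʳ τ (e p))) (≡.sym (⊕-cancelʳ σ (e p))) ⟩
        - (M * (T * minor x y (β ⊕ e p) (α ⊕ e p)))
          ≈⟨ -‿cong (∑-single p (λ q q≢p → other-terms q q≢p)) ⟨
        - ∑ (λ q → M * (t β α q * minor x y (β ⊕ e q) (α ⊕ e q)))
          ≈⟨ -‿cong (*-∑ M) ⟨
        - (M * alternatingForm β α x y)
          ≈⟨ -‿≈0 (y≈0⇒xy≈0 M (alternatingForm-zeroRow zeroRow βα-parity x y)) ⟩
        0# ∎)
      where
      other-terms : ∀ q → q ≢ p → minor x y σ τ * (t (τ ⊕ e p) (σ ⊕ e p) q *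
                    minor x y (τ ⊕ e p ⊕ e q) (σ ⊕ e p ⊕ e q)) ≈ 0#
      other-terms q q≢p with lookup (σ ⊕ τ) q in q∈?
      ... | false = y≈0⇒xy≈0 _ (x≈0⇒xy≈0 _ (t-off _ _ q (≡.trans (≡.cong (λ υ → lookup υ q)
                      (≡.trans (⊕-flip² τ σ (e p)) (⊕-comm τ σ))) q∈?)))
      ... | true  = trans (solve 3 (λ m t n → m :* (t :* n) := t :* (m :* n)) refl _ _ _)
        (y≈0⇒xy≈0 _ (minor-product x y σ τ (τ ⊕ e p ⊕ e q) (σ ⊕ e p ⊕ e q)
          (proportional x y n σ (τ ⊕ e p ⊕ e q) parity-ρ closer)
          (minor-distance-2 x y τ (q≢p ∘ ≡.sym))))
        where
        parity-ρ : π σ ≡ π (τ ⊕ e p ⊕ e q)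
        parity-ρ = ≡.trans (≡.cong π (≡.sym (⊕-cancelʳ σ (e p)))) (π-flip-≡ (σ ⊕ e p) (τ ⊕ e p) p q (π-flip-≡ σ τ p p same-parity))
        weight : wt (σ ⊕ τ) ≡ suc (suc (wt (σ ⊕ (τ ⊕ e p ⊕ e q))))
        weight = ≡.trans (wt-flip (σ ⊕ τ) p p∈) (≡.cong suc (≡.trans
          (wt-flip (σ ⊕ τ ⊕ e p) q (≡.trans (lookup-flip-≢ (σ ⊕ τ) q≢p) q∈?))
          (≡.cong (suc ∘ wt) (≡.trans (≡.cong (_⊕ e q) (⊕-assoc σ τ (e p))) (⊕-assoc σ (τ ⊕ e p) (e q))))))
        closer : wt (σ ⊕ (τ ⊕ e p ⊕ e q)) ℕ.≤ n
        -- The distance has dropped by two; the bound needs only one.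
        closer = ℕ.≤-trans (ℕ.n≤1+n _) (ℕ.s≤s⁻¹ (≡.subst (ℕ._≤ suc n) weight wt≤n))

    -- Pair `x` with the evaluation at a column where row `σ` is nonzero: the vanishing minor
    -- carries `x ⟨ σ ⟩ ≈ 0#` over to `x ⟨ τ ⟩ ≈ 0#`.
    vanishes-on-class : ∀ x {σ τ} → ¬ ZeroRow σ → x ⟨ σ ⟩ ≈ 0# → π σ ≡ π τ → x ⟨ τ ⟩ ≈ 0#
    vanishes-on-class x {σ} {τ} σ≉0 xσ≈0 same-parity = ≈0-stable _ λ xτ≉0 →
      someNonzero σ≉0 λ (ζ , Γ≉0) → let y = evaluation ζ in
      *-≉0 {y ⟨ σ ⟩} (λ yσ≈0 → Γ≉0 (trans (sym (evaluation-$ ζ (Γ σ))) yσ≈0)) xτ≉0 (begin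
        y ⟨ σ ⟩ * x ⟨ τ ⟩
          ≈⟨ solve 4 (λ xσ yτ yσ xτ → yσ :* xτ := xσ :* yτ :- (xσ :* yτ :- yσ :* xτ)) refl
               (x ⟨ σ ⟩) (y ⟨ τ ⟩) (y ⟨ σ ⟩) (x ⟨ τ ⟩) ⟩
        x ⟨ σ ⟩ * y ⟨ τ ⟩ - minor x y σ τ
          ≈⟨ +-≈0 (x≈0⇒xy≈0 _ xσ≈0) (-‿≈0 (proportional x y (wt (σ ⊕ τ)) σ τ same-parity ℕ.≤-refl)) ⟩
        0# ∎)

-- Independent subcubes of rows

-- The subcube of strings that agree with σ off the mask P.
record Within {ℓ} (P σ τ : BitString ℓ) : Set where
  constructor agreeing
  field agree : ∀ i → lookup P i ≡ false → lookup τ i ≡ lookup σ i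

open Within

within-flip : ∀ {ℓ} {P σ τ : BitString ℓ} {q} → lookup P q ≡ true → Within P σ τ → Within P σ (τ ⊕ e q)
within-flip {P = P} {τ = τ} {q} q∈P within .agree i i∉P = ≡.trans
  (lookup-flip-≢ τ (λ i≡q → case ≡.trans (≡.sym i∉P) (≡.trans (≡.cong (lookup P) i≡q) q∈P) of λ ())) (agree within i i∉P)

-- An enumeration of the vertices, so that the rows they index form a family that can be
-- independent; independence then excludes repeated vertices.
record Cube {ℓ} (P σ : BitString ℓ) (n : ℕ) : Set where
  field
    vertex   : Fin n → BitString ℓ
    within   : ∀ j → Within P σ (vertex j)
    complete : ∀ {τ} → Within P σ τ → ∃[ j ] vertex j ≡ τ

open Cube

double : ∀ {ℓ} {P σ : BitString ℓ} {n} p → lookup P p ≡ false → Cube P σ n → Cube (P ⊕ e p) σ (n ℕ.+ n)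
double {P = P} {σ} {n} p p∉P C = record
  { vertex = vertex C ++ shifted
  ; within = within′
  ; complete = complete′
  }
  where
  shifted : Fin n → _
  shifted j = vertex C j ⊕ e p

  p≢ : ∀ {i} → lookup (P ⊕ e p) i ≡ false → i ≢ p
  p≢ i∉ ≡.refl = case ≡.trans (≡.sym i∉) (≡.trans (lookup-flip-≡ P p) (≡.cong not p∉P)) of λ ()

  off : ∀ {i} → lookup (P ⊕ e p) i ≡ false → lookup P i ≡ false
  off i∉ = ≡.trans (≡.sym (lookup-flip-≢ P (p≢ i∉))) i∉

  on : ∀ {i} → i ≢ p → lookup P i ≡ false → lookup (P ⊕ e p) i ≡ false
  on i≢p i∉P = ≡.trans (lookup-flip-≢ P i≢p) i∉P

  within′ : ∀ j → Within (P ⊕ e p) σ ((vertex C ++ shifted) j)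
  within′ j .agree i i∉ with splitAt n j
  ... | inj₁ k = agree (within C k) i (off i∉)
  ... | inj₂ k = ≡.trans (lookup-flip-≢ (vertex C k) (p≢ i∉)) (agree (within C k) i (off i∉))

  complete′ : ∀ {τ} → Within (P ⊕ e p) σ τ → ∃[ j ] (vertex C ++ shifted) j ≡ τ
  complete′ {τ} τ-within with lookup τ p Bool.≟ lookup σ p
  ... | yes eq =
    let j , j≡τ = complete C τ-within-P
    in j ↑ˡ n , ≡.trans (lookup-++ˡ (vertex C) shifted j) j≡τ
    where
    τ-within-P : Within P σ τ
    τ-within-P .agree i i∉P with i Fin.≟ p
    ... | yes ≡.refl = eq
    ... | no i≢p     = agree τ-within i (on i≢p i∉P)
  ... | no ne =
    let j , j≡ = complete C τ⊕p-within-P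
    in n ↑ʳ j , ≡.trans (lookup-++ʳ (vertex C) shifted j) (≡.trans (≡.cong (_⊕ e p) j≡) (⊕-cancelʳ τ (e p)))
    where
    τ⊕p-within-P : Within P σ (τ ⊕ e p)
    τ⊕p-within-P .agree i i∉P with i Fin.≟ p
    ... | yes ≡.refl = ≡.trans (lookup-flip-≡ τ i) (≡.trans (≡.cong not (Bool.¬-not ne)) (Bool.not-involutive _))
    ... | no i≢p     = ≡.trans (lookup-flip-≢ τ i≢p) (agree τ-within i (on i≢p i∉P))

singleton : ∀ {ℓ} (σ : BitString ℓ) → Cube ⊥ σ 1
singleton σ = record
  { vertex   = λ _ → σ
  ; within   = λ _ → agreeing λ _ _ → ≡.refl
  ; complete = λ within → zero , lookup-ext λ i → ≡.sym (agree within i (lookup-⊥ i))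
  }

-- The positions off the mask `P` at which `τ` leaves the subcube of `σ`; their number is the
-- distance from the subcube, on which `maximal⇒spanning` inducts.
departures : ∀ {ℓ} → BitString ℓ → BitString ℓ → BitString ℓ → BitString ℓ
departures P σ τ = zipWith (λ b c → not b ∧ c) P (σ ⊕ τ)

module _ {ℓ} (P σ : BitString ℓ) where

  lookup-departures : ∀ τ i → lookup (departures P σ τ) i ≡ not (lookup P i) ∧ (lookup σ i xor lookup τ i)
  lookup-departures τ i = ≡.trans (Vec.lookup-zipWith _ i P (σ ⊕ τ)) (≡.cong (not (lookup P i) ∧_) (lookup-⊕ σ τ i))

  departures-on : ∀ {τ q} → lookup P q ≡ true → departures P σ (τ ⊕ e q) ≡ departures P σ τ
  departures-on {τ} {q} q∈P = lookup-ext λ i → ≡.trans (lookup-departures (τ ⊕ e q) i)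
    (≡.trans (same i) (≡.sym (lookup-departures τ i)))
    where
    same : ∀ i → not (lookup P i) ∧ (lookup σ i xor lookup (τ ⊕ e q) i) ≡ not (lookup P i) ∧ (lookup σ i xor lookup τ i)
    same i with i Fin.≟ q
    ... | yes ≡.refl rewrite q∈P = ≡.refl
    ... | no i≢q rewrite lookup-flip-≢ τ i≢q = ≡.refl

  departures-off : ∀ {τ q} → lookup P q ≡ false → departures P σ (τ ⊕ e q) ≡ departures P σ τ ⊕ e q
  departures-off {τ} {q} q∉P = lookup-ext λ i → ≡.trans (lookup-departures (τ ⊕ e q) i) (flipped i)
    where
    flipped : ∀ i → not (lookup P i) ∧ (lookup σ i xor lookup (τ ⊕ e q) i) ≡ lookup (departures P σ τ ⊕ e q) i
    flipped i with i Fin.≟ q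
    ... | yes ≡.refl rewrite lookup-flip-≡ (departures P σ τ) i | lookup-departures τ i | q∉P | lookup-flip-≡ τ i =
      ≡.sym (Bool.not-distribʳ-xor (lookup σ i) (lookup τ i))
    ... | no i≢q rewrite lookup-flip-≢ (departures P σ τ) i≢q | lookup-departures τ i | lookup-flip-≢ τ i≢q = ≡.refl

  departs : ∀ {τ i} → lookup P i ≡ false → lookup τ i ≢ lookup σ i → lookup (departures P σ τ) i ≡ true
  departs {τ} {i} i∉P τ≢σ = ≡.trans (lookup-departures τ i)
    (≡.trans (≡.cong (λ b → not b ∧ _) i∉P) (xor-≢ (τ≢σ ∘ ≡.sym)))

  departs⁻¹ : ∀ {τ i} → lookup (departures P σ τ) i ≡ true → lookup P i ≡ false × lookup τ i ≢ lookup σ i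
  departs⁻¹ {τ} {i} eq = analyse (lookup P i) (lookup σ i) (lookup τ i) (≡.trans (≡.sym (lookup-departures τ i)) eq)
    where
    analyse : ∀ b c d → not b ∧ (c xor d) ≡ true → b ≡ false × d ≢ c
    analyse false false true  _ = ≡.refl , λ ()
    analyse false true  false _ = ≡.refl , λ ()

  no-departures⇒within : ∀ {τ} → ¬ (∃[ i ] lookup (departures P σ τ) i ≡ true) → Within P σ τ
  no-departures⇒within {τ} none .agree i i∉P with lookup τ i Bool.≟ lookup σ i
  ... | yes eq = eq
  ... | no ne  = contradiction (i , departs i∉P ne) none

n<2^n : ∀ n → n ℕ.< 2 ℕ.^ n
n<2^n zero    = ℕ.≤-refl
n<2^n (suc n) = ℕ.≤-trans (ℕ.+-mono-≤ (ℕ.m^n>0 2 n) (n<2^n n))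
  (ℕ.+-monoʳ-≤ (2 ℕ.^ n) (ℕ.m≤m+n (2 ℕ.^ n) 0))

module CubeRank (D : StableDomain) {ℓ m : ℕ} (G : MatchgateIdentities D ℓ m) where

  open StableDomain D
  open LinearAlgebra D
  open MatchgateIdentities G
  open Rigidity D G
  open Isolated D G
  open SetoidReasoning setoid
  open IntegerSolver ring using (solve; _:=_; _:+_; _:*_; :-_; _:-_; con)

  module _ {P σ₀ : BitString ℓ} {n} (C : Cube P σ₀ n) (C-independent : IndependentRows (vertex C)) where

    private
      ρ : Fin n → BitString ℓ
      ρ = vertex C

      Kills : Functional (BitString m) → Set
      Kills x = ∀ j → x ⟨ ρ j ⟩ ≈ 0#

      kills-within : ∀ {x τ} → Kills x → Within P σ₀ τ → x ⟨ τ ⟩ ≈ 0#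
      kills-within {x} kills within with complete C within
      ... | j , ≡.refl = kills j

    -- Doubling an independent subcube

    module _ {p} (p∉P : lookup P p ≡ false) where

      private
        ρ⁺ : Fin n → BitString ℓ
        ρ⁺ j = ρ j ⊕ e p

        split-relation : ∀ c → Relation c (ρ ++ ρ⁺) → ∀ ζ →
                         ∑ (λ j → c (j ↑ˡ n) * Γ (ρ j) ζ) + ∑ (λ j → c (n ↑ʳ j) * Γ (ρ⁺ j) ζ) ≈ 0#
        split-relation c rel ζ = begin
          ∑ (λ j → c (j ↑ˡ n) * Γ (ρ j) ζ) + ∑ (λ j → c (n ↑ʳ j) * Γ (ρ⁺ j) ζ)
            ≈⟨ +-cong (∑-cong λ j → reflexive (≡.cong (λ τ → c (j ↑ˡ n) * Γ τ ζ) (lookup-++ˡ ρ ρ⁺ j)))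
                      (∑-cong λ j → reflexive (≡.cong (λ τ → c (n ↑ʳ j) * Γ τ ζ) (lookup-++ʳ ρ ρ⁺ j))) ⟨
          _ ≈⟨ ∑-↑ n ⟨
          ∑ (λ k → c k * Γ ((ρ ++ ρ⁺) k) ζ)
            ≈⟨ rel ζ ⟩
          0# ∎

        join-relation : ∀ a b → (∀ ζ → ∑ (λ j → a j * Γ (ρ j) ζ) + ∑ (λ j → b j * Γ (ρ⁺ j) ζ) ≈ 0#) →
                        Relation (a ++ b) (ρ ++ ρ⁺)
        join-relation a b rel ζ = begin
          ∑ (λ k → (a ++ b) k * Γ ((ρ ++ ρ⁺) k) ζ)
            ≈⟨ ∑-↑ n ⟩
          _ ≈⟨ +-cong (∑-cong λ j → reflexive (≡.cong₂ (λ c τ → c * Γ τ ζ) (lookup-++ˡ a b j) (lookup-++ˡ ρ ρ⁺ j)))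
                      (∑-cong λ j → reflexive (≡.cong₂ (λ c τ → c * Γ τ ζ) (lookup-++ʳ a b j) (lookup-++ʳ ρ ρ⁺ j))) ⟩
          ∑ (λ j → a j * Γ (ρ j) ζ) + ∑ (λ j → b j * Γ (ρ⁺ j) ζ)
            ≈⟨ rel ζ ⟩
          0# ∎

      -- x detects that the row ρ j₀ ⊕ e p lies outside the span of the cube.
      module _ {j₀ x} (x-kills : Kills x) (x≉0 : ¬ (x ⟨ ρ j₀ ⊕ e p ⟩ ≈ 0#))
               {c} (rel : Relation c (ρ ++ ρ⁺)) where

        private
          σ : BitString ℓ
          σ = ρ j₀

          b : Fin n → Carrier
          b j = c (n ↑ʳ j)

          agree-off-P : ∀ j {q} → lookup P q ≡ false → lookup σ q ≡ lookup (ρ j) q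
          agree-off-P j q∉P = ≡.trans (agree (within C j₀) _ q∉P) (≡.sym (agree (within C j) _ q∉P))

          -- Flipping a position of `P` stays inside the cube, where `x` vanishes; off `P` the two
          -- vertices agree and the coefficient is zero. Consequently only the shifted half
          -- contributes in `outer-relation`.
          within-vanishes : ∀ y j → alternatingForm σ (ρ j) x y ≈ 0#
          within-vanishes y j = ∑-≈0 term
            where
            term : ∀ q → t σ (ρ j) q * minor x y (σ ⊕ e q) (ρ j ⊕ e q) ≈ 0#
            term q with lookup P q in q∈?
            ... | true  = y≈0⇒xy≈0 _ (+-≈0 (x≈0⇒xy≈0 _ (kills-within x-kills (within-flip q∈? (within C j₀))))
                            (-‿≈0 (y≈0⇒xy≈0 _ (kills-within x-kills (within-flip q∈? (within C j))))))
            ... | false = x≈0⇒xy≈0 _ (t-off σ (ρ j) q (⊕-≡⇒false σ (ρ j) q (agree-off-P j q∈?)))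

          outer-relation : ∀ y → ∑ (λ j → restrict σ ρ⁺ b j * alternatingForm σ (ρ⁺ j) x y) ≈ 0#
          outer-relation y = begin
            ∑ (λ j → restrict σ ρ⁺ b j * alternatingForm σ (ρ⁺ j) x y)
              ≈⟨ +-identityˡ _ ⟨
            0# + ∑ (λ j → restrict σ ρ⁺ b j * alternatingForm σ (ρ⁺ j) x y)
              ≈⟨ +-cong
                   (∑-≈0 λ j → y≈0⇒xy≈0 _ (trans (reflexive (≡.cong (λ τ → alternatingForm σ τ x y) (lookup-++ˡ ρ ρ⁺ j)))
                     (within-vanishes y j)))
                   (∑-cong λ j → reflexive (≡.cong (λ τ → (if does (π σ ℙ.≟ π τ) then b j else 0#) * alternatingForm σ τ x y)
                     (lookup-++ʳ ρ ρ⁺ j))) ⟨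
            _ ≈⟨ ∑-↑ n ⟨
            ∑ (λ k → restrict σ (ρ ++ ρ⁺) c k * alternatingForm σ ((ρ ++ ρ⁺) k) x y)
              ≈⟨ alternatingForm-relation σ (ρ ++ ρ⁺) c rel x y ⟩
            0# ∎

          p-coefficient : ∀ j → lookup (σ ⊕ ρ⁺ j) p ≡ true
          p-coefficient j = ≡.trans (≡.cong (λ υ → lookup υ p) (≡.sym (⊕-assoc σ (ρ j) (e p))))
            (≡.trans (lookup-flip-≡ (σ ⊕ ρ j) p) (≡.cong not (⊕-≡⇒false σ (ρ j) p (agree-off-P j p∉P))))

          off-coefficient : ∀ j {q} → q ≢ p → lookup σ q ≡ lookup (ρ j) q → t σ (ρ⁺ j) q ≈ 0#
          off-coefficient j {q} q≢p eq = t-off σ (ρ⁺ j) q (⊕-≡⇒false σ (ρ⁺ j) q (≡.trans eq (≡.sym (lookup-flip-≢ (ρ j) q≢p))))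

          p-minor : ∀ y j → minor x y (σ ⊕ e p) (ρ⁺ j ⊕ e p) ≈ x ⟨ σ ⊕ e p ⟩ * y ⟨ ρ j ⟩
          p-minor y j = begin
            minor x y (σ ⊕ e p) (ρ⁺ j ⊕ e p)
              ≡⟨ ≡.cong (minor x y (σ ⊕ e p)) (⊕-cancelʳ (ρ j) (e p)) ⟩
            x ⟨ σ ⊕ e p ⟩ * y ⟨ ρ j ⟩ - y ⟨ σ ⊕ e p ⟩ * x ⟨ ρ j ⟩
              ≈⟨ +-congˡ (-‿≈0 (y≈0⇒xy≈0 _ (x-kills j))) ⟩
            x ⟨ σ ⊕ e p ⟩ * y ⟨ ρ j ⟩ + 0#
              ≈⟨ +-identityʳ _ ⟩
            x ⟨ σ ⊕ e p ⟩ * y ⟨ ρ j ⟩ ∎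

          Neighbour : Fin n → Set
          Neighbour i = ∃[ k ] ρ i ≡ σ ⊕ e k

          neighbour? : ∀ i → Dec (Neighbour i)
          neighbour? i = Fin.any? λ k → Vec.≡-dec Bool._≟_ (ρ i) (σ ⊕ e k)

          parity-⁺ : ∀ {i} → π σ ≢ π (ρ i) → π σ ≡ π (ρ⁺ i)
          parity-⁺ {i} ne = ≡.trans (≢-⁻¹ ne) (≡.sym (π-flip (ρ i) p))

          -- At positions other than `p` off `P` the coefficient is zero. At positions of `P` one
          -- product of the minor contains `x ⟨ σ ⊕ e q ⟩`, which is zero, and the hypothesis
          -- handles the other; it is stated for the product with `t` because in `other` either
          -- factor may be the one that vanishes.
          far-form : ∀ y j → (∀ q → lookup P q ≡ true → t σ (ρ⁺ j) q * y ⟨ σ ⊕ e q ⟩ ≈ 0#) →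
                     alternatingForm σ (ρ⁺ j) x y ≈ t σ (ρ⁺ j) p * (x ⟨ σ ⊕ e p ⟩ * y ⟨ ρ j ⟩)
          far-form y j y≈0 = trans (∑-single p term) (*-congˡ (p-minor y j))
            where
            term : ∀ q → q ≢ p → t σ (ρ⁺ j) q * minor x y (σ ⊕ e q) (ρ⁺ j ⊕ e q) ≈ 0#
            term q q≢p with lookup P q in q∈?
            ... | false = x≈0⇒xy≈0 _ (off-coefficient j q≢p (agree-off-P j q∈?))
            ... | true  = begin
              T * (x ⟨ σ ⊕ e q ⟩ * y ⟨ ρ⁺ j ⊕ e q ⟩ - y ⟨ σ ⊕ e q ⟩ * z)
                ≈⟨ solve 5 (λ t a b c d → t :* (a :* b :- c :* d) := a :* (t :* b) :- (t :* c) :* d) refl _ _ _ _ _ ⟩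
              x ⟨ σ ⊕ e q ⟩ * (T * y ⟨ ρ⁺ j ⊕ e q ⟩) - T * y ⟨ σ ⊕ e q ⟩ * z
                ≈⟨ +-≈0 (x≈0⇒xy≈0 _ (kills-within x-kills (within-flip q∈? (within C j₀))))
                     (-‿≈0 (x≈0⇒xy≈0 _ (y≈0 q q∈?))) ⟩
              0# ∎
              where
              T = t σ (ρ⁺ j) q
              z = x ⟨ ρ⁺ j ⊕ e q ⟩

        -- Let `y` separate `ρ i` from the other vertices. As `ρ i` is not adjacent to `σ`, `y`
        -- vanishes on all neighbours of `σ` in the cube, so `outer-relation` collapses to a nonzero
        -- multiple of `b i`.
        far-vanishes : ∀ {i} → π σ ≢ π (ρ i) → ¬ Neighbour i → b i ≈ 0#
        far-vanishes {i} ne far = ≈0-stable _ λ bᵢ≉0 →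
          separating (λ j → Γ (ρ j)) C-independent i λ (y , yᵢ≉0 , y≈0) →
          let T = t σ (ρ⁺ i) p
              form : ∀ j → alternatingForm σ (ρ⁺ j) x y ≈ t σ (ρ⁺ j) p * (x ⟨ σ ⊕ e p ⟩ * y ⟨ ρ j ⟩)
              form j = far-form y j λ q q∈P →
                let k , k≡ = complete C (within-flip q∈P (within C j₀))
                in y≈0⇒xy≈0 _ (trans (reflexive (≡.cong (y ⟨_⟩) (≡.sym k≡))) (y≈0 k λ { ≡.refl → far (q , k≡) }))
          in *-≉0 bᵢ≉0 (*-≉0 (t-on σ (ρ⁺ i) p (parity-⁺ ne) (p-coefficient i)) (*-≉0 x≉0 yᵢ≉0)) (begin
            b i * (T * (x ⟨ σ ⊕ e p ⟩ * y ⟨ ρ i ⟩))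
              ≈⟨ *-cong (restrict-≡ σ ρ⁺ b i (parity-⁺ ne)) (form i) ⟨
            restrict σ ρ⁺ b i * alternatingForm σ (ρ⁺ i) x y
              ≈⟨ ∑-single i (λ j j≢i → y≈0⇒xy≈0 _ (trans (form j) (y≈0⇒xy≈0 _ (y≈0⇒xy≈0 _ (y≈0 j j≢i))))) ⟨
            ∑ (λ j → restrict σ ρ⁺ b j * alternatingForm σ (ρ⁺ j) x y)
              ≈⟨ outer-relation y ⟩
            0# ∎)

        -- Here `ρ i` is `σ ⊕ e k`, where the separating `y` does not vanish, so a second term
        -- arises at `k`. Its coefficient and its minor are both opposite to those at `p`, so the
        -- two terms add up to twice `Z`. The other vertices contribute nothing, the far ones by
        -- `far-vanishes`.
        near-vanishes : ∀ {i} → π σ ≢ π (ρ i) → Neighbour i → b i ≈ 0#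
        near-vanishes {i} ne (k , ρᵢ≡) = ≈0-stable _ λ bᵢ≉0 →
          separating (λ j → Γ (ρ j)) C-independent i λ (y , yᵢ≉0 , y≈0) →
          let T = t σ (ρ⁺ i) p
              Z = T * (x ⟨ σ ⊕ e p ⟩ * y ⟨ ρ i ⟩)
          in *-≉0 bᵢ≉0 (*-≉0 (t-on σ (ρ⁺ i) p (parity-⁺ ne) (p-coefficient i)) (*-≉0 x≉0 yᵢ≉0))
            (x+x≈0⇒x≈0 _ (begin
              b i * Z + b i * Z
                ≈⟨ distribˡ _ _ _ ⟨
              b i * (Z + Z)
                ≈⟨ *-cong (restrict-≡ σ ρ⁺ b i (parity-⁺ ne)) (near-form y y≈0) ⟨
              restrict σ ρ⁺ b i * alternatingForm σ (ρ⁺ i) x y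
                ≈⟨ ∑-single i (λ j j≢i → other y y≈0 j j≢i) ⟨
              ∑ (λ j → restrict σ ρ⁺ b j * alternatingForm σ (ρ⁺ j) x y)
                ≈⟨ outer-relation y ⟩
              0# ∎))
          where
          k∈P : lookup P k ≡ true
          k∈P with lookup P k in k∈?
          ... | true  = ≡.refl
          ... | false = contradiction (≡.trans (agree-off-P i k∈?)
            (≡.trans (≡.cong (λ υ → lookup υ k) ρᵢ≡) (lookup-flip-≡ σ k))) (Bool.not-¬ ≡.refl)

          k≢p : k ≢ p
          k≢p ≡.refl = case ≡.trans (≡.sym k∈P) p∉P of λ ()

          σ⊕ρ⁺ : σ ⊕ ρ⁺ i ≡ e k ⊕ e p
          σ⊕ρ⁺ = ≡.trans (≡.cong (λ υ → σ ⊕ (υ ⊕ e p)) ρᵢ≡) (≡.trans (≡.cong (σ ⊕_) (⊕-assoc σ (e k) (e p)))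
            (≡.trans (⊕-comm σ _) (≡.trans (≡.cong (_⊕ σ) (⊕-comm σ (e k ⊕ e p))) (⊕-cancelʳ (e k ⊕ e p) σ))))

          near-form : ∀ y → (∀ j → j ≢ i → y ⟨ ρ j ⟩ ≈ 0#) →
                      let Z = t σ (ρ⁺ i) p * (x ⟨ σ ⊕ e p ⟩ * y ⟨ ρ i ⟩) in
                      alternatingForm σ (ρ⁺ i) x y ≈ Z + Z
          near-form y y≈0 = begin
            alternatingForm σ (ρ⁺ i) x y
              ≈⟨ ∑-pair (k≢p ∘ ≡.sym) (λ q q≢p q≢k → x≈0⇒xy≈0 _ (t-off σ (ρ⁺ i) q
                   (≡.trans (≡.cong (λ υ → lookup υ q) σ⊕ρ⁺) (≡.trans (lookup-flip-≢ (e k) q≢p) (lookup-e-≢ q≢k))))) ⟩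
            T * minor x y (σ ⊕ e p) (ρ⁺ i ⊕ e p) + t σ (ρ⁺ i) k * minor x y (σ ⊕ e k) (ρ⁺ i ⊕ e k)
              ≡⟨ ≡.cong₂ (λ υ ω → T * minor x y (σ ⊕ e p) (ρ⁺ i ⊕ e p) + t σ (ρ⁺ i) k * minor x y υ ω)
                   (≡.sym ρᵢ≡) (≡.trans (⊕-swapʳ (ρ i) (e p) (e k)) (≡.cong (_⊕ e p)
                     (≡.trans (≡.cong (_⊕ e k) ρᵢ≡) (⊕-cancelʳ σ (e k))))) ⟩
            T * minor x y (σ ⊕ e p) (ρ⁺ i ⊕ e p) + t σ (ρ⁺ i) k * minor x y (ρ i) (σ ⊕ e p)
              ≈⟨ +-cong (*-congˡ (p-minor y i)) (*-cong (t-pair σ (ρ⁺ i) k≢p σ⊕ρ⁺) (+-congʳ (x≈0⇒xy≈0 _ (x-kills i)))) ⟩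
            T * (x ⟨ σ ⊕ e p ⟩ * y ⟨ ρ i ⟩) + (- T) * (0# - y ⟨ ρ i ⟩ * x ⟨ σ ⊕ e p ⟩)
              ≈⟨ solve 3 (λ t a b → t :* (a :* b) :+ (:- t) :* (con (+ 0) :- b :* a) := t :* (a :* b) :+ t :* (a :* b)) refl _ _ _ ⟩
            T * (x ⟨ σ ⊕ e p ⟩ * y ⟨ ρ i ⟩) + T * (x ⟨ σ ⊕ e p ⟩ * y ⟨ ρ i ⟩) ∎
            where T = t σ (ρ⁺ i) p

          other : ∀ y → (∀ j → j ≢ i → y ⟨ ρ j ⟩ ≈ 0#) → ∀ j → j ≢ i →
                  restrict σ ρ⁺ b j * alternatingForm σ (ρ⁺ j) x y ≈ 0#
          other y y≈0 j j≢i with π σ ℙ.≟ π (ρ j) | neighbour? j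
          ... | yes eq | _ = x≈0⇒xy≈0 _ (restrict-≢ σ ρ⁺ b j (λ eq′ →
            ℙ.p≢p⁻¹ (π (ρ j)) (≡.trans (≡.sym eq) (≡.trans eq′ (π-flip (ρ j) p)))))
          ... | no ne | no far = x≈0⇒xy≈0 _ (trans (restrict-≡ σ ρ⁺ b j (parity-⁺ ne)) (far-vanishes ne far))
          ... | no ne | yes (k′ , ρⱼ≡) = y≈0⇒xy≈0 _ (trans (far-form y j on-P)
                  (y≈0⇒xy≈0 _ (y≈0⇒xy≈0 _ (y≈0 j j≢i))))
            where
            on-P : ∀ q → lookup P q ≡ true → t σ (ρ⁺ j) q * y ⟨ σ ⊕ e q ⟩ ≈ 0#
            -- At `k` the coefficient is zero, since `σ` and `ρ⁺ j` differ only at `k′` and `p`; at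
            -- any other position of `P`, `σ ⊕ e q` is a vertex different from `ρ i`, and `y`
            -- vanishes there.
            on-P q q∈P with q Fin.≟ k
            ... | yes ≡.refl = x≈0⇒xy≈0 _ (off-coefficient j k≢p (≡.sym (≡.trans (≡.cong (λ υ → lookup υ k) ρⱼ≡)
                    (lookup-flip-≢ σ λ { ≡.refl → j≢i (independent⇒injective Γ ρ C-independent (≡.trans ρⱼ≡ (≡.sym ρᵢ≡))) }))))
            ... | no q≢k =
              let h , h≡ = complete C (within-flip q∈P (within C j₀))
              in y≈0⇒xy≈0 _ (trans (reflexive (≡.cong (y ⟨_⟩) (≡.sym h≡))) (y≈0 h λ { ≡.refl →
                   q≢k (flip-injective (≡.trans (≡.sym h≡) ρᵢ≡)) }))
              where
              flip-injective : σ ⊕ e q ≡ σ ⊕ e k → q ≡ k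
              flip-injective eq with q Fin.≟ k
              ... | yes q≡k = q≡k
              ... | no q≢k  = contradiction (≡.trans (≡.sym (lookup-flip-≢ σ q≢k))
                    (≡.trans (≡.cong (λ υ → lookup υ q) (≡.sym eq)) (lookup-flip-≡ σ q))) (Bool.not-¬ ≡.refl)

        opposite-vanishes : ∀ {i} → π σ ≢ π (ρ i) → b i ≈ 0#
        opposite-vanishes {i} ne with neighbour? i
        ... | yes near = near-vanishes ne near
        ... | no far   = far-vanishes ne far

      -- The coefficients of the shifted rows fall into two classes, by the parity of the vertex.
      -- `opposite-vanishes` at `j₀` settles the class opposite to `ρ j₀`; the neighbour `ρ j₁`
      -- inside the cube, available because `k` lies in `P`, settles the other. What remains is a
      -- relation between the rows of the cube itself.
      double-independent : ∀ {k} → lookup P k ≡ true → ∀ {j₀ x} → Kills x → ¬ (x ⟨ ρ j₀ ⊕ e p ⟩ ≈ 0#) →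
                           IndependentRows (ρ ++ ρ⁺)
      double-independent {k} k∈P {j₀} {x} x-kills x≉0 c rel i = by-half (splitAt n i) ≡.refl
        where
        j₁ : Fin n
        j₁ = proj₁ (complete C (within-flip k∈P (within C j₀)))

        π-j₁ : π (ρ j₁) ≡ π (ρ j₀) ℙ.⁻¹
        π-j₁ = ≡.trans (≡.cong π (proj₂ (complete C (within-flip k∈P (within C j₀))))) (π-flip (ρ j₀) k)

        j₀≁j₁ : π (ρ j₀) ≢ π (ρ j₁)
        j₀≁j₁ eq = ℙ.p≢p⁻¹ _ (≡.trans eq π-j₁)

        -- The rows of the parity opposite to ρ j₀ being settled, ρ⁺ j₁ lies
        -- outside the span of the cube, and so j₁ can take over the role of j₀.
        with-neighbour : IndependentRows (ρ⁺ j₁ ◂ ρ)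
        with-neighbour a a-rel = λ { zero → a₀≈0 ; (suc j) → a≈0 j }
          where
          -- Padded with zeros, the relation becomes one between the rows of the doubled cube, to
          -- which `opposite-vanishes` applies at `j₁`.
          indicator : Fin n → Carrier
          indicator j = a zero * δ j₁ j
          joined : ∀ ζ → ∑ (λ j → a (suc j) * Γ (ρ j) ζ) + ∑ (λ j → indicator j * Γ (ρ⁺ j) ζ) ≈ 0#
          joined ζ = begin
            ∑ (λ j → a (suc j) * Γ (ρ j) ζ) + ∑ (λ j → indicator j * Γ (ρ⁺ j) ζ)
              ≈⟨ +-congˡ (trans (∑-single j₁ λ j j≢ → x≈0⇒xy≈0 _ (y≈0⇒xy≈0 _ (δ-≢ j≢)))
                   (*-congʳ (trans (*-congˡ (δ-≡ j₁)) (*-identityʳ _)))) ⟩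
            ∑ (λ j → a (suc j) * Γ (ρ j) ζ) + a zero * Γ (ρ⁺ j₁) ζ
              ≈⟨ trans (+-comm _ _) (sym ∑-suc) ⟩
            ∑ (λ j → a j * Γ ((ρ⁺ j₁ ◂ ρ) j) ζ)
              ≈⟨ a-rel ζ ⟩
            0# ∎
          a₀≈0 : a zero ≈ 0#
          a₀≈0 = begin
            a zero                          ≈⟨ trans (*-congˡ (δ-≡ j₁)) (*-identityʳ _) ⟨
            indicator j₁                    ≡⟨ lookup-++ʳ (a ∘ suc) indicator j₁ ⟨
            ((a ∘ suc) ++ indicator) (n ↑ʳ j₁)
              ≈⟨ opposite-vanishes x-kills x≉0 (join-relation (a ∘ suc) indicator joined) j₀≁j₁ ⟩
            0#                              ∎
          a≈0 : ∀ j → a (suc j) ≈ 0#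
          a≈0 = C-independent (a ∘ suc) λ ζ → begin
            ∑ (λ j → a (suc j) * Γ (ρ j) ζ)                        ≈⟨ trans (+-congʳ (x≈0⇒xy≈0 _ a₀≈0)) (+-identityˡ _) ⟨
            a zero * Γ (ρ⁺ j₁) ζ + ∑ (λ j → a (suc j) * Γ (ρ j) ζ) ≈⟨ trans (sym ∑-suc) (a-rel ζ) ⟩
            0#                                                     ∎

        outer : ∀ j → c (n ↑ʳ j) ≈ 0#
        outer j with π (ρ j₀) ℙ.≟ π (ρ j)
        ... | no ne  = opposite-vanishes x-kills x≉0 rel ne
        ... | yes eq = ≈0-stable _ λ cⱼ≉0 →
          separating (λ i → Γ ((ρ⁺ j₁ ◂ ρ) i)) with-neighbour zero λ (x′ , x′≉0 , x′≈0) →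
          cⱼ≉0 (opposite-vanishes (λ j → x′≈0 (suc j) λ ()) x′≉0 rel (λ eq′ → j₀≁j₁ (≡.trans eq (≡.sym eq′))))

        inner : ∀ j → c (j ↑ˡ n) ≈ 0#
        inner = C-independent (λ j → c (j ↑ˡ n)) λ ζ → begin
          ∑ (λ j → c (j ↑ˡ n) * Γ (ρ j) ζ)
            ≈⟨ trans (+-congˡ (∑-≈0 λ j → x≈0⇒xy≈0 _ (outer j))) (+-identityʳ _) ⟨
          ∑ (λ j → c (j ↑ˡ n) * Γ (ρ j) ζ) + ∑ (λ j → c (n ↑ʳ j) * Γ (ρ⁺ j) ζ)
            ≈⟨ split-relation c rel ζ ⟩
          0# ∎

        by-half : ∀ h → splitAt n i ≡ h → c i ≈ 0#
        by-half (inj₁ j) eq = ≡.subst (λ i → c i ≈ 0#) (Fin.splitAt⁻¹-↑ˡ eq) (inner j)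
        by-half (inj₂ j) eq = ≡.subst (λ i → c i ≈ 0#) (Fin.splitAt⁻¹-↑ʳ eq) (outer j)

    -- From a maximal independent subcube to all rows

    private
      -- Were there no such relation, the cube together with the adjacent row would be independent,
      -- and a functional separating that row would contradict `vanishes`.
      dependence : ∀ {p j} → (∀ x → Kills x → x ⟨ ρ j ⊕ e p ⟩ ≈ 0#) →
                   ¬ ¬ (Σ (Fin (suc n) → Carrier) λ a → Relation a ((ρ j ⊕ e p) ◂ ρ) × ¬ (a zero ≈ 0#))
      dependence {p} {j} vanishes none =
        separating (λ i → Γ (((ρ j ⊕ e p) ◂ ρ) i)) independent zero λ (x , x≉0 , x≈0) →
        x≉0 (vanishes x λ i → x≈0 (suc i) λ ())
        where
        independent : IndependentRows ((ρ j ⊕ e p) ◂ ρ)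
        independent a rel = λ { zero → a₀≈0 ; (suc i) → a≈0 i }
          where
          a₀≈0 : a zero ≈ 0#
          a₀≈0 = ≈0-stable _ λ a₀≉0 → none (a , rel , a₀≉0)
          a≈0 : ∀ i → a (suc i) ≈ 0#
          a≈0 = C-independent (a ∘ suc) λ ζ → begin
            ∑ (λ i → a (suc i) * Γ (ρ i) ζ)
              ≈⟨ trans (+-congʳ (x≈0⇒xy≈0 _ a₀≈0)) (+-identityˡ _) ⟨
            a zero * Γ (ρ j ⊕ e p) ζ + ∑ (λ i → a (suc i) * Γ (ρ i) ζ)
              ≈⟨ trans (sym ∑-suc) (rel ζ) ⟩
            0# ∎

    -- Induction on the distance of `τ` from the cube. At distance two or more, take `β` one step
    -- closer and `α` adjacent to the cube in the same direction, and apply `rowForm-relation` to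
    -- the dependence of `α` on the cube. By induction, or because the coefficient is zero, every
    -- term vanishes except the one for `α` at `p`, which contains `x ⟨ τ ⟩`.
    maximal⇒spanning : ∀ {k} → lookup P k ≡ true →
                       (∀ p → lookup P p ≡ false → ∀ j x → Kills x → x ⟨ ρ j ⊕ e p ⟩ ≈ 0#) → Spanning ρ
    maximal⇒spanning {k} k∈P neighbours x x-kills τ = go (wt (departures P σ₀ τ)) τ ℕ.≤-refl
      where
      -- As `k` lies in `P`, both `σ₀` and `σ₀ ⊕ e k` are vertices, and they represent the two
      -- parities.
      same-class : ∀ τ → ∃[ j ] π (ρ j) ≡ π τ
      same-class τ with π σ₀ ℙ.≟ π τ
      ... | yes eq = let j , j≡ = complete C {σ₀} (agreeing λ _ _ → ≡.refl) in j , ≡.trans (≡.cong π j≡) eq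
      ... | no ne  = let j , j≡ = complete C {σ₀ ⊕ e k} (within-flip k∈P (agreeing λ _ _ → ≡.refl)) in
        j , ≡.trans (≡.cong π j≡) (≡.trans (π-flip σ₀ k) (≡.sym (≢-⁻¹ (ne ∘ ≡.sym))))

      go : ∀ N τ → wt (departures P σ₀ τ) ℕ.≤ N → x ⟨ τ ⟩ ≈ 0#
      go N τ wt≤N with Fin.any? (λ i → lookup (departures P σ₀ τ) i Bool.≟ true)
      go N τ wt≤N | no none = kills-within x-kills (no-departures⇒within P σ₀ none)
      go zero τ wt≤N | yes (p , p∈) = contradiction (lookup≡true⇒0<wt (departures P σ₀ τ) p p∈) (ℕ.≤⇒≯ wt≤N)
      go (suc N) τ wt≤N | yes (p , p∈) with Fin.any? (λ i → lookup (departures P σ₀ (τ ⊕ e p)) i Bool.≟ true)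
      ... | no none =
        let j , j≡ = complete C (no-departures⇒within P σ₀ none)
        in trans (reflexive (≡.cong (x ⟨_⟩) (≡.trans (≡.sym (⊕-cancelʳ τ (e p))) (≡.cong (_⊕ e p) (≡.sym j≡)))))
             (neighbours p (proj₁ (departs⁻¹ P σ₀ {τ} p∈)) j x x-kills)
      ... | yes (p′ , p′∈) = ≈0-stable _ λ xτ≉0 →
        dependence (neighbours p p∉P j₁) λ (a , rel , a₀≉0) →
        separating (λ j → Γ (ρ j)) C-independent j₁ λ (y , y≉0 , _) →
        *-≉0 a₀≉0 (*-≉0 (t-on β α p β∼α β⊕α∋p) (*-≉0 xτ≉0 y≉0)) (begin
          a zero * (t β α p * (x ⟨ τ ⟩ * y ⟨ ρ j₁ ⟩))
            ≡⟨ ≡.cong₂ (λ υ ω → a zero * (t β α p * (x ⟨ υ ⟩ * y ⟨ ω ⟩)))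
                 (≡.sym (⊕-cancelʳ τ (e p))) (≡.sym (⊕-cancelʳ (ρ j₁) (e p))) ⟩
          a zero * (t β α p * (x ⟨ β ⊕ e p ⟩ * y ⟨ α ⊕ e p ⟩))
            ≈⟨ *-cong (restrict-≡ β (α ◂ ρ) a zero β∼α) (∑-single p λ q q≢p → vanishing-term y α q λ q∉P →
                 ≡.trans (lookup-flip-≢ (ρ j₁) q≢p) (agree (within C j₁) q q∉P)) ⟨
          restrict β (α ◂ ρ) a zero * rowForm β α x y
            ≈⟨ ∑-single zero (λ { zero ne → contradiction ≡.refl ne
                                ; (suc j) _ → y≈0⇒xy≈0 _ (∑-≈0 λ q → vanishing-term y (ρ j) q (agree (within C j) q)) }) ⟨
          ∑ (λ j → restrict β (α ◂ ρ) a j * rowForm β ((α ◂ ρ) j) x y)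
            ≈⟨ rowForm-relation β (α ◂ ρ) a rel β∉ x y ⟩
          0# ∎)
        where
        p∉P = proj₁ (departs⁻¹ P σ₀ {τ} p∈)
        j₁ = proj₁ (same-class τ)
        α = ρ j₁ ⊕ e p
        β = τ ⊕ e p

        β∼α : π β ≡ π α
        β∼α = π-flip-≡ τ (ρ j₁) p p (≡.sym (proj₂ (same-class τ)))

        τₚ≢ : lookup τ p ≢ lookup (ρ j₁) p
        τₚ≢ eq = proj₂ (departs⁻¹ P σ₀ {τ} p∈) (≡.trans eq (agree (within C j₁) p p∉P))

        β⊕α∋p : lookup (β ⊕ α) p ≡ true
        β⊕α∋p = ≡.trans (≡.cong (λ υ → lookup υ p) (⊕-flip² τ (ρ j₁) (e p))) (⊕-≢⇒true τ (ρ j₁) p τₚ≢)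

        β∉ : ∀ j → β ≢ (α ◂ ρ) j
        β∉ zero    eq = τₚ≢ (≡.cong (λ υ → lookup υ p) (≡.trans (≡.sym (⊕-cancelʳ τ (e p)))
          (≡.trans (≡.cong (_⊕ e p) eq) (⊕-cancelʳ (ρ j₁) (e p)))))
        -- The second departure `p′` keeps `β` off the cube; this is where a distance of at least
        -- two enters.
        β∉ (suc j) eq = let p′∉P , β≢ = departs⁻¹ P σ₀ {β} p′∈ in
          β≢ (≡.trans (≡.cong (λ υ → lookup υ p′) eq) (agree (within C j) p′ p′∉P))

        wtβ≤N : wt (departures P σ₀ β) ℕ.≤ N
        wtβ≤N = ℕ.s≤s⁻¹ (≡.subst (ℕ._≤ suc N) (≡.trans (wt-flip (departures P σ₀ τ) p p∈)
          (≡.cong (suc ∘ wt) (≡.sym (departures-off P σ₀ {τ} p∉P)))) wt≤N)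

        vanishing-term : ∀ y υ q → (lookup P q ≡ false → lookup υ q ≡ lookup σ₀ q) →
                         t β υ q * (x ⟨ β ⊕ e q ⟩ * y ⟨ υ ⊕ e q ⟩) ≈ 0#
        -- A neighbour of `β` along `P` is as far from the cube as `β`, and undoing a departure
        -- brings it closer; the induction covers both.
        vanishing-term y υ q υ≡σ₀ with lookup P q in q∈? | lookup β q Bool.≟ lookup σ₀ q
        ... | true  | _      = y≈0⇒xy≈0 _ (x≈0⇒xy≈0 _ (go N (β ⊕ e q)
                (≡.subst (λ υ → wt υ ℕ.≤ N) (≡.sym (departures-on P σ₀ q∈?)) wtβ≤N)))
        ... | false | yes eq = x≈0⇒xy≈0 _ (t-off β υ q (⊕-≡⇒false β υ q (≡.trans eq (≡.sym (υ≡σ₀ ≡.refl)))))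
        ... | false | no ne  = y≈0⇒xy≈0 _ (x≈0⇒xy≈0 _ (go N (β ⊕ e q) (ℕ.≤-trans (ℕ.n≤1+n _)
                (≡.subst (ℕ._≤ N) (≡.trans (wt-flip (departures P σ₀ β) q (departs P σ₀ {β} q∈? ne))
                  (≡.cong (suc ∘ wt) (≡.sym (departures-off P σ₀ {β} q∈?)))) wtβ≤N))))

  -- The rank from independent and spanning rows

  module _ {r} (c : Fin r → BitString m) (c-independent : Independent (λ k σ → Γ σ (c k)))
           (c-maximal : ∀ s (c : Fin s → BitString m) → Independent (λ k σ → Γ σ (c k)) → s ℕ.≤ r) where

    independent⇒≤rank : ∀ {n} {ρ : Fin n → BitString ℓ} → IndependentRows ρ → n ℕ.≤ r
    independent⇒≤rank {n} {ρ} independent = decidable-stable (n ℕ.≤? r) λ n≰r →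
      rows⇒columns (λ j → Γ (ρ j)) independent λ (c′ , c′-independent) →
      n≰r (c-maximal n c′ λ a rel → c′-independent a (λ j → rel (ρ j)))

    -- For the second inequality, the `r` independent columns remain independent on the rows `ρ`: a
    -- relation between them there is a functional vanishing on `ρ`, hence on all rows.
    basis⇒≡rank : ∀ {n} {ρ : Fin n → BitString ℓ} → IndependentRows ρ → Spanning ρ → n ≡ r
    basis⇒≡rank {ρ = ρ} independent spanning = ℕ.≤-antisym (independent⇒≤rank independent)
      (independent⇒≤ (λ k j → Γ (ρ j) (c k)) λ a rel → c-independent a λ σ →
        let x = functional a c in
        trans (reflexive (≡.sym ($≡∑ x))) (spanning x (λ j → trans (reflexive ($≡∑ x)) (rel j)) σ))

    PowerOfTwo : Set
    PowerOfTwo = ∃[ κ ] r ≡ 2 ℕ.^ κ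

    -- Either every row adjacent to the cube lies in its span and the cube is a basis, or some
    -- direction doubles it. The invariant `r ℕ.< κ ℕ.+ fuel` bounds the number of doublings.
    grow : ∀ fuel {κ n P σ₀ k} (C : Cube P σ₀ n) → n ≡ 2 ℕ.^ κ → IndependentRows (vertex C) →
           lookup P k ≡ true → r ℕ.< κ ℕ.+ fuel → ¬ ¬ PowerOfTwo
    -- Without fuel, `r` is below `κ`, hence below `2 ℕ.^ κ`, although the cube has that many
    -- independent rows.
    grow zero {κ} C n≡ independent k∈P r<κ none = ℕ.<-irrefl ≡.refl (ℕ.<-≤-trans
      (ℕ.<-trans (≡.subst (r ℕ.<_) (ℕ.+-identityʳ κ) r<κ) (n<2^n κ))
      (≡.subst (ℕ._≤ r) n≡ (independent⇒≤rank independent)))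
    grow (suc fuel) {κ} {n} {P} {k = k} C n≡ independent k∈P r<κ none =
      none (κ , ≡.trans (≡.sym (basis⇒≡rank independent (maximal⇒spanning C independent k∈P
        -- A functional detecting an adjacent row would allow a doubling, and the recursive call
        -- would refute `none`.
        λ p p∉P j x x-kills → ≈0-stable _ λ x≉0 →
          grow fuel {suc κ} (double p p∉P C)
            (≡.trans (≡.cong₂ ℕ._+_ n≡ n≡) (≡.cong (2 ℕ.^ κ ℕ.+_) (≡.sym (ℕ.+-identityʳ _))))
            (double-independent C independent p∉P k∈P x-kills x≉0)
            (≡.trans (lookup-flip-≢ P λ { ≡.refl → case ≡.trans (≡.sym k∈P) p∉P of λ () }) k∈P)
            (≡.subst (r ℕ.<_) (ℕ.+-suc κ fuel) r<κ) none))) n≡)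

    -- Under `none` nonzero rows are isolated, since two adjacent ones would start `grow` from a
    -- cube of dimension one. Then a nonzero row spans its parity class, and one or two classes with
    -- a nonzero row give rank 1 or 2.
    rank-powerOfTwo : ¬ (∀ τ → ZeroRow τ) → ¬ ¬ PowerOfTwo
    rank-powerOfTwo Γ≉0 none = Γ≉0 λ σ ζ → ≈0-stable _ λ Γσζ≉0 →
      let σ≉0 : ¬ ZeroRow σ
          σ≉0 zeroRow = Γσζ≉0 (zeroRow ζ)
      in none (0 , ≡.sym (basis⇒≡rank {ρ = λ (_ : Fin 1) → σ}
           (distinct-parities (λ { {zero} {zero} ne _ → ne ≡.refl }) (λ _ → σ≉0))
           λ x x≈0 τ → case π σ ℙ.≟ π τ of λ
             { (yes eq) → vanishes-on-class isolated x σ≉0 (x≈0 zero) eq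
             ; (no ne)  → $-≈0 x (opposite-zero σ σ≉0 τ ne) }))
      where
      isolated : ∀ α p → ¬ ZeroRow α → ZeroRow (α ⊕ e p)
      isolated α p α≉0 ζ = ≈0-stable _ λ ne →
        grow (suc r) {1} (double p (lookup-⊥ p) (singleton α)) ≡.refl
          (distinct-parities
            (λ { {zero} {zero} ne _ → ne ≡.refl
               ; {zero} {suc zero} _ eq → ℙ.p≢p⁻¹ _ (≡.trans eq (π-flip α p))
               ; {suc zero} {zero} _ eq → ℙ.p≢p⁻¹ _ (≡.trans (≡.sym eq) (π-flip α p))
               ; {suc zero} {suc zero} ne _ → ne ≡.refl })
            (λ { zero → α≉0 ; (suc zero) zeroRow → ne (zeroRow ζ) }))
          (≡.trans (lookup-flip-≡ ⊥ p) (≡.cong not (lookup-⊥ p)))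
          (ℕ.m<n⇒m<1+n (ℕ.n<1+n r)) none

      opposite-zero : ∀ σ → ¬ ZeroRow σ → ∀ τ → π σ ≢ π τ → ZeroRow τ
      opposite-zero σ σ≉0 τ σ≁τ ζ = ≈0-stable _ λ ne →
        let τ≉0 : ¬ ZeroRow τ
            τ≉0 zeroRow = ne (zeroRow ζ)
        -- Nonzero rows of both parities would form a basis of size two.
        in none (1 , ≡.sym (basis⇒≡rank {ρ = σ ◂ λ (_ : Fin 1) → τ}
             (distinct-parities
               (λ { {zero} {zero} ne _ → ne ≡.refl
                  ; {zero} {suc zero} _ eq → σ≁τ eq
                  ; {suc zero} {zero} _ eq → σ≁τ (≡.sym eq)
                  ; {suc zero} {suc zero} ne _ → ne ≡.refl })
               (λ { zero → σ≉0 ; (suc zero) → τ≉0 }))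
             λ x x≈0 υ → case π σ ℙ.≟ π υ of λ
               { (yes eq) → vanishes-on-class isolated x σ≉0 (x≈0 zero) eq
               ; (no ne)  → vanishes-on-class isolated x τ≉0 (x≈0 (suc zero))
                   (≡.trans (≢-⁻¹ (σ≁τ ∘ ≡.sym)) (≡.sym (≢-⁻¹ (ne ∘ ≡.sym)))) }))

-- From signs to coefficients

ones-∷ : ∀ {n} b (ρ : BitString n) → filter (λ i → Bool.T? (lookup (b ∷ ρ) i)) (List.tabulate suc) ≡ map Fin.suc (ones ρ)
ones-∷ b ρ = ≡.trans (≡.cong (filter _) (≡.sym (List.map-tabulate id suc))) (filter-map (allFin _))
  where
  filter-map : ∀ xs → filter (λ i → Bool.T? (lookup (b ∷ ρ) i)) (map Fin.suc xs) ≡ map Fin.suc (filter (λ i → Bool.T? (lookup ρ i)) xs)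
  filter-map []       = ≡.refl
  filter-map (x ∷ xs) with lookup ρ x
  ... | true  = ≡.cong (suc x ∷_) (filter-map xs)
  ... | false = filter-map xs

ones-true : ∀ {n} (ρ : BitString n) → ones (true ∷ ρ) ≡ zero ∷ map Fin.suc (ones ρ)
ones-true ρ = ≡.cong (zero ∷_) (ones-∷ true ρ)

ones-false : ∀ {n} (ρ : BitString n) → ones (false ∷ ρ) ≡ map Fin.suc (ones ρ)
ones-false ρ = ones-∷ false ρ

ones-[] : ∀ {n} (ρ : BitString n) → ones ρ ≡ [] → ∀ i → lookup ρ i ≡ false
ones-[] (true ∷ ρ)  eq i = case ≡.trans (≡.sym (ones-true ρ)) eq of λ ()
ones-[] (false ∷ ρ) eq zero = ≡.refl
ones-[] (false ∷ ρ) eq (suc i) = ones-[] ρ (map-[] (≡.trans (≡.sym (ones-false ρ)) eq)) i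
  where
  map-[] : ∀ {n} {xs : List (Fin n)} → map Fin.suc xs ≡ [] → xs ≡ []
  map-[] {xs = []} _ = ≡.refl

ℂ-stableDomain : StableDomain
ℂ-stableDomain = record
  { ring           = ℂ-commutativeRing
  ; ≈0-stable      = ≋0-stable
  ; noZeroDivisors = *ᶜ-noZeroDivisors
  ; 1≉0            = 1ᶜ≉0ᶜ
  ; x+x≈0⇒x≈0      = z+z≋0⇒z≋0
  }

-- Alternating sums as sums over all positions

module AlternatingSum (D : StableDomain) where

  open StableDomain D
  open LinearAlgebra D
  open SetoidReasoning setoid
  open IntegerSolver ring using (solve; _:=_; _:*_; :-_)

  -‿≉0 : ∀ {x} → ¬ (x ≈ 0#) → ¬ (- x ≈ 0#)
  -‿≉0 {x} x≉0 -x≈0 = x≉0 (trans (solve 1 (λ x → x := :- (:- x)) refl x) (-‿≈0 -x≈0))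

  -- The sign of `p` among the ones of `ρ`: minus one to the number of ones before `p`, and zero
  -- when `p` is not among them.
  alternation : ∀ {n} → BitString n → Fin n → Carrier
  alternation (true ∷ ρ)  zero    = 1#
  alternation (false ∷ ρ) zero    = 0#
  alternation (true ∷ ρ)  (suc p) = - alternation ρ p
  alternation (false ∷ ρ) (suc p) = alternation ρ p

  alternation-off : ∀ {n} (ρ : BitString n) p → lookup ρ p ≡ false → alternation ρ p ≈ 0#
  alternation-off (false ∷ ρ) zero    _   = refl
  alternation-off (true ∷ ρ)  (suc p) p∉ρ = -‿≈0 (alternation-off ρ p p∉ρ)
  alternation-off (false ∷ ρ) (suc p) p∉ρ = alternation-off ρ p p∉ρ

  alternation-on : ∀ {n} (ρ : BitString n) p → lookup ρ p ≡ true → ¬ (alternation ρ p ≈ 0#)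
  alternation-on (true ∷ ρ)  zero    _   = 1≉0
  alternation-on (true ∷ ρ)  (suc p) p∈ρ = -‿≉0 (alternation-on ρ p p∈ρ)
  alternation-on (false ∷ ρ) (suc p) p∈ρ = alternation-on ρ p p∈ρ

  alternation-e : ∀ {n} (p : Fin n) → alternation (e p) p ≈ 1#
  alternation-e zero    = refl
  alternation-e (suc p) = alternation-e p

  alternation-pair : ∀ {n} {p q : Fin n} → p ≢ q → alternation (e p ⊕ e q) p ≈ - alternation (e p ⊕ e q) q
  alternation-pair {p = zero}  {zero}  p≢q = contradiction ≡.refl p≢q
  alternation-pair {p = zero}  {suc q} p≢q = begin
    1#                                ≈⟨ solve 1 (λ x → x := :- (:- x)) refl 1# ⟩
    - (- 1#)                          ≈⟨ -‿cong (-‿cong (alternation-e q)) ⟨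
    - (- alternation (e q) q)         ≡⟨ ≡.cong (λ υ → - (- alternation υ q)) (≡.trans (⊕-comm ⊥ (e q)) (⊕-⊥ (e q))) ⟨
    - (- alternation (⊥ ⊕ e q) q)     ∎
  alternation-pair {p = suc p} {zero}  p≢q = -‿cong (trans
    (reflexive (≡.cong (λ υ → alternation υ p) (⊕-⊥ (e p)))) (alternation-e p))
  alternation-pair {p = suc p} {suc q} p≢q = alternation-pair (p≢q ∘ ≡.cong suc)

  -- The nested subtraction negates everything after a leading one, as `alternation` does; positions
  -- outside `ρ` enter with coefficient zero.
  foldr-ones : ∀ {n} (ρ : BitString n) (f : Fin n → Carrier) →
               foldr _-_ 0# (map f (ones ρ)) ≈ ∑ (λ p → alternation ρ p * f p)
  foldr-ones []          f = sym (∑-≈0 λ ())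
  foldr-ones (true ∷ ρ)  f = begin
    foldr _-_ 0# (map f (ones (true ∷ ρ)))
      ≡⟨ ≡.cong (foldr _-_ 0#) (≡.trans (≡.cong (map f) (ones-true ρ)) (≡.cong (f zero ∷_) (≡.sym (List.map-∘ (ones ρ))))) ⟩
    f zero - foldr _-_ 0# (map (f ∘ suc) (ones ρ))
      ≈⟨ +-congˡ (-‿cong (foldr-ones ρ (f ∘ suc))) ⟩
    f zero - ∑ (λ p → alternation ρ p * f (suc p))
      ≈⟨ +-cong (sym (*-identityˡ _)) (sym ∑-neg) ⟩
    1# * f zero + ∑ (λ p → - (alternation ρ p * f (suc p)))
      ≈⟨ +-congˡ (∑-cong λ p → solve 2 (λ a b → :- (a :* b) := (:- a) :* b) refl (alternation ρ p) (f (suc p))) ⟩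
    1# * f zero + ∑ (λ p → - alternation ρ p * f (suc p))
      ≈⟨ ∑-suc ⟨
    ∑ (λ p → alternation (true ∷ ρ) p * f p) ∎
  foldr-ones (false ∷ ρ) f = begin
    foldr _-_ 0# (map f (ones (false ∷ ρ)))
      ≡⟨ ≡.cong (foldr _-_ 0#) (≡.trans (≡.cong (map f) (ones-false ρ)) (≡.sym (List.map-∘ (ones ρ)))) ⟩
    foldr _-_ 0# (map (f ∘ suc) (ones ρ))
      ≈⟨ foldr-ones ρ (f ∘ suc) ⟩
    ∑ (λ p → alternation ρ p * f (suc p))
      ≈⟨ trans (+-congʳ (zeroˡ _)) (+-identityˡ _) ⟨
    0# * f zero + ∑ (λ p → alternation ρ p * f (suc p))
      ≈⟨ ∑-suc ⟨
    ∑ (λ p → alternation (false ∷ ρ) p * f p) ∎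

  signed : Sign → Carrier
  signed Sign.+ = 1#
  signed Sign.- = - 1#

  signed≉0 : ∀ s → ¬ (signed s ≈ 0#)
  signed≉0 Sign.+ = 1≉0
  signed≉0 Sign.- = -‿≉0 1≉0

  signed-square : ∀ s → signed s * signed s ≈ 1#
  signed-square Sign.+ = *-identityˡ 1#
  signed-square Sign.- = trans (solve 1 (λ x → (:- x) :* (:- x) := x :* x) refl 1#) (*-identityˡ 1#)

  signed-* : ∀ s s′ → signed (s Sign.* s′) ≈ signed s * signed s′
  signed-* Sign.+ s′     = sym (*-identityˡ _)
  signed-* Sign.- Sign.+ = sym (*-identityʳ _)
  signed-* Sign.- Sign.- = sym (signed-square Sign.-)

-- The signed identities of a pseudo-signature in unshifted form

module _ {ℓ m} (Γ : Matrix ℓ m) (parity-condition : ParityCondition Γ)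
         (mgi : MatchgateIdentitiesUpToSign Γ) where

  open StableDomain ℂ-stableDomain using (_≈_; _*_; -_; setoid; sym; trans; reflexive; *-congˡ; *-congʳ; *-assoc; *-identityˡ)
  open LinearAlgebra ℂ-stableDomain using (∑; ∑-cong; *-∑; y≈0⇒xy≈0; *-≉0)
  open AlternatingSum ℂ-stableDomain
  open RingProperties (CommutativeRing.ring ℂ-commutativeRing) using (-‿distribʳ-*; -1*x≈-x)
  open SetoidReasoning setoid

  private
    ε = proj₁ mgi
    δ = proj₁ (proj₂ mgi)
    ε-sym = proj₁ (proj₂ (proj₂ mgi))
    identities = proj₂ (proj₂ (proj₂ mgi))

  -- The list is meant to be `ones (α ⊕ β)`, whose head gives the shift. The empty case is a default
  -- that arises only for equal rows.
  rowSign : BitString ℓ → BitString ℓ → List (Fin ℓ) → Sign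
  rowSign α β []      = Sign.+
  rowSign α β (p ∷ _) = δ (α ⊕ e p) (β ⊕ e p)

  ◃-signed : ∀ s z → s ◃ z ≈ signed s * z
  ◃-signed Sign.+ z = sym (*-identityˡ z)
  ◃-signed Sign.- z = sym (-1*x≈-x z)

  -- Apply the given identity to `α ⊕ e p₁` and `β ⊕ e p₁`: their sum mod 2 is still `α ⊕ β`, and
  -- flipping `p₁` twice cancels. The sign `δ` squares to one, so it may be moved to the row side.
  unshifted : ∀ α β → α ≢ β → π α ≡ π β → ∀ ζ η →
    ∑ (λ p → signed (rowSign α β (ones (α ⊕ β))) * alternation (α ⊕ β) p * (Γ (α ⊕ e p) ζ * Γ (β ⊕ e p) η)) ≈
    ∑ (λ q → signed (ε ζ η) * alternation (ζ ⊕ η) q * (Γ α (ζ ⊕ e q) * Γ β (η ⊕ e q)))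
  unshifted α β α≢β α∼β ζ η with ones (α ⊕ β) in eq
  ... | [] = contradiction (lookup-ext λ i → ⊕-≢true⇒≡ α β i λ i∈ →
        case ≡.trans (≡.sym i∈) (ones-[] (α ⊕ β) eq i) of λ ()) α≢β
  ... | p₁ ∷ ps = begin
    ∑ (λ p → signed s * alternation (α ⊕ β) p * f p)
      ≈⟨ trans (∑-cong λ p → *-assoc _ _ _) (sym (*-∑ (signed s))) ⟩
    signed s * ∑ (λ p → alternation (α ⊕ β) p * f p)
      ≈⟨ *-congˡ (foldr-ones (α ⊕ β) f) ⟨
    signed s * alternatingSum (map f (ones (α ⊕ β)))
      ≡⟨ ≡.cong (λ ps → signed s * alternatingSum ps) (≡.trans (≡.cong (map f) eq) (List.map-cong f-shift (p₁ ∷ ps))) ⟩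
    signed s * alternatingSum (map (λ p → Γ (σ ⊕ e p₁ ⊕ e p) ζ * Γ (τ ⊕ e p₁ ⊕ e p) η) (p₁ ∷ ps))
      ≈⟨ *-congˡ (identities σ τ σ≢τ (≡.trans (≡.cong π σ⊕τ) (π-≡⇒⊕≡0 α β α∼β)) ζ η p₁ ps (≡.trans (≡.cong ones σ⊕τ) eq)) ⟩
    signed s * ((s Sign.* ε ζ η) ◃ alternatingSum (map (λ q → Γ (σ ⊕ e p₁) (ζ ⊕ e q) * Γ (τ ⊕ e p₁) (η ⊕ e q)) (ones (ζ ⊕ η))))
      ≡⟨ ≡.cong (λ zs → signed s * ((s Sign.* ε ζ η) ◃ alternatingSum zs)) (List.map-cong g-shift (ones (ζ ⊕ η))) ⟩
    signed s * ((s Sign.* ε ζ η) ◃ alternatingSum (map g (ones (ζ ⊕ η))))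
      ≈⟨ *-congˡ (trans (◃-signed (s Sign.* ε ζ η) _) (trans (*-congʳ (signed-* s (ε ζ η))) (*-assoc _ _ _))) ⟩
    signed s * (signed s * (signed (ε ζ η) * alternatingSum (map g (ones (ζ ⊕ η)))))
      ≈⟨ trans (sym (*-assoc _ _ _)) (trans (*-congʳ (signed-square s)) (*-identityˡ _)) ⟩
    signed (ε ζ η) * alternatingSum (map g (ones (ζ ⊕ η)))
      ≈⟨ *-congˡ (foldr-ones (ζ ⊕ η) g) ⟩
    signed (ε ζ η) * ∑ (λ q → alternation (ζ ⊕ η) q * g q)
      ≈⟨ trans (*-∑ (signed (ε ζ η))) (∑-cong λ q → sym (*-assoc _ _ _)) ⟩
    ∑ (λ q → signed (ε ζ η) * alternation (ζ ⊕ η) q * g q) ∎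
    where
    σ = α ⊕ e p₁
    τ = β ⊕ e p₁
    s = δ σ τ
    f : Fin ℓ → ℂ
    f p = Γ (α ⊕ e p) ζ * Γ (β ⊕ e p) η
    g : Fin m → ℂ
    g q = Γ α (ζ ⊕ e q) * Γ β (η ⊕ e q)
    f-shift : ∀ p → f p ≡ Γ (σ ⊕ e p₁ ⊕ e p) ζ * Γ (τ ⊕ e p₁ ⊕ e p) η
    f-shift p = ≡.cong₂ (λ υ ω → Γ (υ ⊕ e p) ζ * Γ (ω ⊕ e p) η) (≡.sym (⊕-cancelʳ α (e p₁))) (≡.sym (⊕-cancelʳ β (e p₁)))
    g-shift : ∀ q → Γ (σ ⊕ e p₁) (ζ ⊕ e q) * Γ (τ ⊕ e p₁) (η ⊕ e q) ≡ g q
    g-shift q = ≡.cong₂ (λ υ ω → Γ υ (ζ ⊕ e q) * Γ ω (η ⊕ e q)) (⊕-cancelʳ α (e p₁)) (⊕-cancelʳ β (e p₁))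
    σ⊕τ : σ ⊕ τ ≡ α ⊕ β
    σ⊕τ = ⊕-flip² α β (e p₁)
    σ≢τ : σ ≢ τ
    σ≢τ eq = α≢β (≡.trans (≡.sym (⊕-cancelʳ α (e p₁))) (≡.trans (≡.cong (_⊕ e p₁) eq) (⊕-cancelʳ β (e p₁))))

  pseudoSignature⇒matchgateIdentities : MatchgateIdentities ℂ-stableDomain ℓ m
  pseudoSignature⇒matchgateIdentities = record
    { Γ           = Γ
    -- Both entries lie in the column `ζ`, whose parity cancels.
    ; homogeneous = λ σ τ ζ σ≉0 τ≉0 → ℙ.+-cancelʳ-≡ (π ζ) (π σ) (π τ) (≡.trans (≡.sym (ℙ.+-homo-+ (wt σ) (wt ζ)))
        (≡.trans (parity-condition σ ζ τ ζ σ≉0 τ≉0) (ℙ.+-homo-+ (wt τ) (wt ζ))))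
    ; t           = λ α β p → signed (rowSign α β (ones (α ⊕ β))) * alternation (α ⊕ β) p
    ; t-off       = λ α β p p∉ → y≈0⇒xy≈0 _ (alternation-off (α ⊕ β) p p∉)
    ; t-on        = λ α β p _ p∈ → *-≉0 (signed≉0 (rowSign α β (ones (α ⊕ β)))) (alternation-on (α ⊕ β) p p∈)
    ; t-pair      = t-pair
    ; u           = λ ζ η q → signed (ε ζ η) * alternation (ζ ⊕ η) q
    ; u-sym       = λ ζ η q → reflexive (≡.cong₂ (λ s υ → signed s * alternation υ q) (ε-sym ζ η) (⊕-comm ζ η))
    ; identity    = unshifted
    }
    where
    t-pair : ∀ α β {p q} → p ≢ q → α ⊕ β ≡ e p ⊕ e q →
             signed (rowSign α β (ones (α ⊕ β))) * alternation (α ⊕ β) p ≈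
             - (signed (rowSign α β (ones (α ⊕ β))) * alternation (α ⊕ β) q)
    t-pair α β {p} {q} p≢q eq = begin
      s * alternation (α ⊕ β) p         ≡⟨ ≡.cong (λ υ → s * alternation υ p) eq ⟩
      s * alternation (e p ⊕ e q) p     ≈⟨ *-congˡ (alternation-pair p≢q) ⟩
      s * - alternation (e p ⊕ e q) q   ≈⟨ -‿distribʳ-* _ _ ⟨
      - (s * alternation (e p ⊕ e q) q) ≡⟨ ≡.cong (λ υ → - (s * alternation υ q)) eq ⟨
      - (s * alternation (α ⊕ β) q)     ∎
      where s = signed (rowSign α β (ones (α ⊕ β)))

-- The rank of a complex pseudo-signature

open import Data.Nat.Base using (_+_; _^_; _≥_)

theorem4p1 : ∀ {ℓ m : ℕ} (Γ : Matrix ℓ m) → IsPseudoSignature Γ → NonzeroMatrix Γ →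
    ∀ (r : ℕ) → HasRank Γ r →
    (∃[ κ ] r ≡ 2 ^ κ) ×
    (∀ (κ : ℕ) → κ ≥ 1 → r ≥ 2 ^ κ + 1 → r ≥ 2 ^ (κ + 1))
theorem4p1 Γ (parity-condition , mgi) Γ≉0 r ((c , c-independent) , c-maximal) = powerOfTwo , λ κ _ → jump powerOfTwo κ
  where
  open CubeRank ℂ-stableDomain (pseudoSignature⇒matchgateIdentities Γ parity-condition mgi)
  open StableDomain ℂ-stableDomain using (reflexive; trans)
  open LinearAlgebra ℂ-stableDomain using (∑≡sum)

  powerOfTwo : ∃[ κ ] r ≡ 2 ^ κ
  powerOfTwo =
    -- An exponent is smaller than its power of two, here `r`, so the search is bounded and
    -- decidable and the double negation can be removed.
    let κ , _ , r≡ = decidable-stable (ℕ.anyUpTo? (λ κ → r ℕ.≟ 2 ^ κ) (suc r)) λ none →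
          rank-powerOfTwo c (λ a rel → c-independent a λ σ → trans (reflexive (≡.sym ∑≡sum)) (rel σ))
            (λ s c independent → c-maximal s c λ a rel → independent a λ σ → trans (reflexive ∑≡sum) (rel σ))
            Γ≉0 λ (κ , r≡) → none (κ , ℕ.m<n⇒m<1+n (≡.subst (κ ℕ.<_) (≡.sym r≡) (n<2^n κ)) , r≡)
    in κ , r≡

  -- Powers of two are monotone in the exponent, so a rank above `2 ^ κ` has an exponent of at least
  -- `κ + 1`.
  jump : ∃[ κ′ ] r ≡ 2 ^ κ′ → ∀ κ → r ≥ 2 ^ κ + 1 → r ≥ 2 ^ (κ + 1)
  jump (κ′ , ≡.refl) κ large with ℕ.≤-<-connex κ′ κ
  ... | inj₁ κ′≤κ = contradiction (ℕ.^-monoʳ-≤ 2 κ′≤κ) (ℕ.<⇒≱ (≡.subst (ℕ._≤ 2 ^ κ′) (ℕ.+-comm (2 ^ κ) 1) large))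
  ... | inj₂ κ<κ′ = ℕ.^-monoʳ-≤ 2 (≡.subst (ℕ._≤ κ′) (ℕ.+-comm 1 κ) κ<κ′)
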